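{- Let $\mathcal{V}=(V,K)$ be a vector space in the two-sorted language $\mathrm{L}$ (or $\mathrm{L}_{W,\lambda}$, or any other interpretable language). Then $\mathcal{V}$ is NIP if and only if $K$ is NIP.
   Context: $\mathrm{L}=\{V,+,0\}\cup\{K,+,\cdot,0,1\}\cup\{\mathrm{scal}:K\times V\to V\}$ is the two-sorted language of vector spaces over a non-fixed field $K$, where $\mathrm{scal}$ is scalar multiplication. $K$ is considered as a pure field. $\mathrm{L}_{W,\lambda}=\mathrm{L}\cup\{W_n\subset V^n\}_n\cup\{\lambda_{n,i}:V^{n+1}\to K\}_{1\le i\le n}$, where $W_n$ is the set of $K$-linearly independent $n$-tuples of vectors, and $\lambda_{n,i}(v,v_1,\dots,v_n)=\lambda_i$ if $W_n(v_1,\dots,v_n)$ and $v=\sum_{i}\lambda_iv_i$, and $=0$ if $v_1,\dots,v_n$ are linearly dependent or $v,v_1,\dots,v_n$ are linearly independent. These symbols are definable in $\mathrm{L}$. -}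

module Defs where

open import Level using (Level; _⊔_; 0ℓ; Lift) renaming (suc to lsuc)
open import Algebra.Bundles using (CommutativeRing)
open import Algebra.Module.Bundles using (LeftModule)
open import Axiom.ExcludedMiddle using (ExcludedMiddle)
open import Data.Empty.Polymorphic using (⊥)
open import Data.Fin.Base using (Fin; zero; suc)
open import Data.Fin.Subset using (Subset; _∈_)
open import Data.List.Base using (List; []; _∷_; _++_; replicate; concatMap)
import Data.List.Membership.Propositional as List
open import Data.List.Relation.Unary.All as All using (All; []; _∷_)
open import Data.List.Relation.Unary.All.Properties using (++⁺; map⁻; concat⁻)
open import Data.Nat.Base using (ℕ; zero; suc)
open import Data.Product.Base using (Σ-syntax; ∃-syntax; _×_; _,_)
open import Data.Unit.Base using (tt) renaming (⊤ to ⊤₀)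
open import Data.Unit.Polymorphic using (⊤)
open import Data.Vec.Functional using (Vector)
open import Function.Bundles using (_⇔_)
open import Relation.Binary.Bundles using (Setoid)
open import Relation.Nullary using (¬_; Dec; yes; no; contradiction)

record Language (l : Level) : Set (lsuc l) where
  field
    Sort : Set l
    Func : List Sort → Sort → Set l
    Rel  : List Sort → Set l

module _ {l : Level} (L : Language l) where
  open Language L

  data Term (Γ : List Sort) : Sort → Set l where
    var  : ∀ {s} → s List.∈ Γ → Term Γ s
    func : ∀ {ss s} → Func ss s → All (Term Γ) ss → Term Γ s

  -- The remaining connectives and ∃ are the usual classical abbreviations.
  data Formula (Γ : List Sort) : Set l where
    falsum : Formula Γ
    equal  : ∀ {s} → Term Γ s → Term Γ s → Formula Γ
    rel    : ∀ {ss} → Rel ss → All (Term Γ) ss → Formula Γ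
    imp    : Formula Γ → Formula Γ → Formula Γ
    all    : ∀ s → Formula (s ∷ Γ) → Formula Γ

module _ {l p q r : Level} {S : Set l} {P : S → Set p} {Q : S → Set q}
         (_∼_ : ∀ {s} → P s → Q s → Set r) where

  Pointwise : ∀ {ss} → All P ss → All Q ss → Set r
  Pointwise []       []       = ⊤
  Pointwise (x ∷ xs) (y ∷ ys) = x ∼ y × Pointwise xs ys

module _ {l c ℓ : Level} {S : Set l} (D : S → Setoid c ℓ) where

  TupleOver : List S → Set (l ⊔ c)
  TupleOver = All (λ s → Setoid.Carrier (D s))

  PointwiseEqual : ∀ {ss} → TupleOver ss → TupleOver ss → Set ℓ
  PointwiseEqual = Pointwise (λ {s} → Setoid._≈_ (D s))

-- Every sort is a setoid, whose equivalence interprets the equality symbol.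
record Structure {l : Level} (L : Language l) (c ℓ : Level) : Set (l ⊔ lsuc (c ⊔ ℓ)) where
  open Language L
  field
    domain : Sort → Setoid c ℓ

  Elem : Sort → Set c
  Elem s = Setoid.Carrier (domain s)

  Tuple : List Sort → Set (l ⊔ c)
  Tuple = TupleOver domain

  infix 4 _≈_ _≈*_

  _≈_ : ∀ {s} → Elem s → Elem s → Set ℓ
  _≈_ {s} = Setoid._≈_ (domain s)

  _≈*_ : ∀ {ss} → Tuple ss → Tuple ss → Set ℓ
  _≈*_ = PointwiseEqual domain

  field
    ⟦_⟧ᶠ     : ∀ {ss s} → Func ss s → Tuple ss → Elem s
    ⟦⟧ᶠ-cong : ∀ {ss s} (f : Func ss s) {xs ys : Tuple ss} →
               xs ≈* ys → ⟦ f ⟧ᶠ xs ≈ ⟦ f ⟧ᶠ ys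
    ⟦_⟧ʳ     : ∀ {ss} → Rel ss → Tuple ss → Set (c ⊔ ℓ)
    ⟦⟧ʳ-resp : ∀ {ss} (R : Rel ss) {xs ys : Tuple ss} →
               xs ≈* ys → ⟦ R ⟧ʳ xs → ⟦ R ⟧ʳ ys

  graph : ∀ {ss s} → Func ss s → Tuple (s ∷ ss) → Set ℓ
  graph f (y ∷ xs) = ⟦ f ⟧ᶠ xs ≈ y

  equality : ∀ {s} → Tuple (s ∷ s ∷ []) → Set ℓ
  equality (x ∷ y ∷ []) = x ≈ y

module _ {l c ℓ : Level} {L : Language l} where
  open Language L
  open Structure

  mutual
    eval : (M : Structure L c ℓ) → ∀ {Γ s} → Tuple M Γ → Term L Γ s → Elem M s
    eval M ρ (var x)     = All.lookup ρ x
    eval M ρ (func f ts) = ⟦ M ⟧ᶠ f (evals M ρ ts)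

    evals : (M : Structure L c ℓ) → ∀ {Γ ss} → Tuple M Γ → All (Term L Γ) ss → Tuple M ss
    evals M ρ []       = []
    evals M ρ (t ∷ ts) = eval M ρ t ∷ evals M ρ ts

  infix 4 _⊨_[_]

  _⊨_[_] : (M : Structure L c ℓ) → ∀ {Γ} → Formula L Γ → Tuple M Γ → Set (c ⊔ ℓ)
  M ⊨ falsum    [ ρ ] = ⊥
  M ⊨ equal t u [ ρ ] = Lift c (_≈_ M (eval M ρ t) (eval M ρ u))
  M ⊨ rel R ts  [ ρ ] = ⟦ M ⟧ʳ R (evals M ρ ts)
  M ⊨ imp φ ψ   [ ρ ] = M ⊨ φ [ ρ ] → M ⊨ ψ [ ρ ]
  M ⊨ all s φ   [ ρ ] = ∀ (x : Elem M s) → M ⊨ φ [ x ∷ ρ ]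

  -- φ(x ; y), with x ranging over Γ-tuples and y over Δ-tuples, shatters
  -- sets of every finite size in M.  By compactness this is equivalent to
  -- the existence of an infinite shattered set in some model of Th(M).
  HasIP : (M : Structure L c ℓ) → ∀ Γ Δ → Formula L (Γ ++ Δ) → Set (l ⊔ c ⊔ ℓ)
  HasIP M Γ Δ φ = ∀ n →
    Σ[ a ∈ (Fin n → Tuple M Γ) ] Σ[ b ∈ (Subset n → Tuple M Δ) ]
      (∀ i I → M ⊨ φ [ ++⁺ (a i) (b I) ] ⇔ i ∈ I)

  NIP : Structure L c ℓ → Set (l ⊔ c ⊔ ℓ)
  NIP M = ∀ {Γ Δ} (φ : Formula L (Γ ++ Δ)) → ¬ HasIP M Γ Δ φ

  -- The tuple b consists of parameters.
  Definable : (M : Structure L c ℓ) → ∀ {p Γ} → (Tuple M Γ → Set p) → Set (l ⊔ c ⊔ ℓ ⊔ p)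
  Definable M {Γ = Γ} P =
    Σ[ Π ∈ List Sort ] Σ[ b ∈ Tuple M Π ] Σ[ φ ∈ Formula L (Γ ++ Π) ]
      (∀ x → P x ⇔ M ⊨ φ [ ++⁺ x b ])

-- Interpretations of N in M: each sort s of N is a quotient of a definable
-- set of (dim s)-tuples of M.  The coordinate map is given as the relation
-- Represents x a, a partial surjection x ↦ a.  Definability of its domain
-- and independence of representatives follow from equal-definable.
record Interpretation
  {l c ℓ l′ c′ ℓ′ : Level} {L : Language l} {L′ : Language l′}
  (N : Structure L′ c′ ℓ′) (M : Structure L c ℓ) :
  Set (lsuc (l ⊔ c ⊔ ℓ ⊔ l′ ⊔ c′ ⊔ ℓ′)) where
  private
    module L = Language L
    module L′ = Language L′
    module M = Structure M
    module N = Structure N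
  field
    dim        : L′.Sort → List L.Sort
    Represents : ∀ {s} → M.Tuple (dim s) → N.Elem s → Set (c ⊔ ℓ ⊔ c′ ⊔ ℓ′)
    functional : ∀ {s} {x : M.Tuple (dim s)} {a b : N.Elem s} →
                 Represents x a → Represents x b → a N.≈ b
    respects   : ∀ {s} {x : M.Tuple (dim s)} {a b : N.Elem s} →
                 a N.≈ b → Represents x a → Represents x b
    surjective : ∀ {s} (a : N.Elem s) → ∃[ x ] Represents x a

  Preimage : ∀ {p ss} → (N.Tuple ss → Set p) →
             M.Tuple (concatMap dim ss) → Set (l′ ⊔ c ⊔ ℓ ⊔ c′ ⊔ ℓ′ ⊔ p)
  Preimage P x = ∃[ a ] (Pointwise Represents (map⁻ (concat⁻ x)) a × P a)

  field
    equal-definable : ∀ s → Definable M (Preimage (N.equality {s}))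
    func-definable  : ∀ {ss s} (f : L′.Func ss s) → Definable M (Preimage (N.graph f))
    rel-definable   : ∀ {ss} (R : L′.Rel ss) → Definable M (Preimage N.⟦ R ⟧ʳ)

record Field (c ℓ : Level) : Set (lsuc (c ⊔ ℓ)) where
  field
    commutativeRing : CommutativeRing c ℓ

  open CommutativeRing commutativeRing public

  field
    0≉1     : ¬ (0# ≈ 1#)
    inverse : ∀ x → ¬ (x ≈ 0#) → ∃[ y ] (x * y ≈ 1#)

data FieldFunc : List ⊤₀ → ⊤₀ → Set where
  add mul  : FieldFunc (tt ∷ tt ∷ []) tt
  nil unit : FieldFunc [] tt

data NoRel {S : Set} : List S → Set where

fieldLanguage : Language 0ℓ
fieldLanguage = record { Sort = ⊤₀ ; Func = FieldFunc ; Rel = NoRel }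

module _ {c ℓ : Level} (K : Field c ℓ) where
  open Field K

  fieldStructure : Structure fieldLanguage c ℓ
  fieldStructure = record
    { domain   = λ _ → setoid
    ; ⟦_⟧ᶠ     = λ { add (x ∷ y ∷ []) → x + y
                   ; mul (x ∷ y ∷ []) → x * y
                   ; nil []           → 0#
                   ; unit []          → 1# }
    ; ⟦⟧ᶠ-cong = λ { add {_ ∷ _ ∷ []} {_ ∷ _ ∷ []} (p , q , _) → +-cong p q
                   ; mul {_ ∷ _ ∷ []} {_ ∷ _ ∷ []} (p , q , _) → *-cong p q
                   ; nil {[]} {[]} _                           → refl
                   ; unit {[]} {[]} _                          → refl }
    ; ⟦_⟧ʳ     = λ ()
    ; ⟦⟧ʳ-resp = λ ()
    }

data VSort : Set where
  vector scalar : VSort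

data VFunc : List VSort → VSort → Set where
  addⱽ      : VFunc (vector ∷ vector ∷ []) vector
  nilⱽ      : VFunc [] vector
  add mul   : VFunc (scalar ∷ scalar ∷ []) scalar
  nil unit  : VFunc [] scalar
  scal      : VFunc (scalar ∷ vector ∷ []) vector

vectorSpaceLanguage : Language 0ℓ
vectorSpaceLanguage = record { Sort = VSort ; Func = VFunc ; Rel = NoRel }

data VFuncWλ : List VSort → VSort → Set where
  base : ∀ {ss s} → VFunc ss s → VFuncWλ ss s
  coef : ∀ n → Fin n → VFuncWλ (vector ∷ replicate n vector) scalar

data VRelWλ : List VSort → Set where
  W : ∀ n → VRelWλ (replicate n vector)

vectorSpaceLanguageWλ : Language 0ℓ
vectorSpaceLanguageWλ = record { Sort = VSort ; Func = VFuncWλ ; Rel = VRelWλ }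

module _ {a s} {S : Set s} {P : S → Set a} {x : S} where
  toVector : ∀ n → All P (replicate n x) → Vector (P x) n
  toVector (suc n) (y ∷ ys) zero    = y
  toVector (suc n) (y ∷ ys) (suc i) = toVector n ys i

module _ {c ℓ : Level} (K : Field c ℓ) (V : LeftModule (Field.ring K) c ℓ) where
  open Field K hiding (zero)
  open LeftModule V
  open import Algebra.Module.Properties.LeftModule V using (inverseʳ-uniqueᴹ)
  open import Algebra.Properties.CommutativeMonoid.Sum +ᴹ-commutativeMonoid
    using (sum; sum-cong-≋; ∑-distrib-+)
  open import Algebra.Properties.Ring ring using (x∙y⁻¹≈ε⇒x≈y)
  import Relation.Binary.Reasoning.Setoid ≈ᴹ-setoid as ≈ᴹ-Reasoning

  linearCombination : ∀ {n} → Vector Carrier n → Vector Carrierᴹ n → Carrierᴹ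
  linearCombination k v = sum (λ i → k i *ₗ v i)

  LinearlyIndependent : ∀ {n} → Vector Carrierᴹ n → Set (c ⊔ ℓ)
  LinearlyIndependent {n} v =
    ∀ (k : Vector Carrier n) → linearCombination k v ≈ᴹ 0ᴹ → ∀ i → k i ≈ 0#

  VDomain : VSort → Setoid c ℓ
  VDomain vector = ≈ᴹ-setoid
  VDomain scalar = setoid

  vectorSpaceStructure : Structure vectorSpaceLanguage c ℓ
  vectorSpaceStructure = record
    { domain   = VDomain
    ; ⟦_⟧ᶠ     = λ { addⱽ (v ∷ w ∷ []) → v +ᴹ w
                   ; nilⱽ []           → 0ᴹ
                   ; add (x ∷ y ∷ [])  → x + y
                   ; mul (x ∷ y ∷ [])  → x * y
                   ; nil []            → 0#
                   ; unit []           → 1#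
                   ; scal (x ∷ v ∷ []) → x *ₗ v }
    ; ⟦⟧ᶠ-cong = λ { addⱽ {_ ∷ _ ∷ []} {_ ∷ _ ∷ []} (p , q , _) → +ᴹ-cong p q
                   ; nilⱽ {[]} {[]} _                           → ≈ᴹ-refl
                   ; add {_ ∷ _ ∷ []} {_ ∷ _ ∷ []} (p , q , _)  → +-cong p q
                   ; mul {_ ∷ _ ∷ []} {_ ∷ _ ∷ []} (p , q , _)  → *-cong p q
                   ; nil {[]} {[]} _                            → refl
                   ; unit {[]} {[]} _                           → refl
                   ; scal {_ ∷ _ ∷ []} {_ ∷ _ ∷ []} (p , q , _) → *ₗ-cong p q }
    ; ⟦_⟧ʳ     = λ ()
    ; ⟦⟧ʳ-resp = λ ()
    }

  open Structure vectorSpaceStructure using () renaming (⟦_⟧ᶠ to ⟦_⟧ⱽ; ⟦⟧ᶠ-cong to ⟦⟧ⱽ-cong)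

  toVector-cong : ∀ n {xs ys : TupleOver VDomain (replicate n vector)} →
                  PointwiseEqual VDomain xs ys →
                  ∀ i → toVector n xs i ≈ᴹ toVector n ys i
  toVector-cong (suc n) {_ ∷ _} {_ ∷ _} (p , ps) zero    = p
  toVector-cong (suc n) {_ ∷ _} {_ ∷ _} (p , ps) (suc i) = toVector-cong n ps i

  linearCombination-cong : ∀ {n} (k : Vector Carrier n) {v w : Vector Carrierᴹ n} →
    (∀ i → v i ≈ᴹ w i) → linearCombination k v ≈ᴹ linearCombination k w
  linearCombination-cong k v≈w = sum-cong-≋ (λ i → *ₗ-cong refl (v≈w i))

  LinearlyIndependent-resp : ∀ {n} {v w : Vector Carrierᴹ n} →
    (∀ i → v i ≈ᴹ w i) → LinearlyIndependent v → LinearlyIndependent w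
  LinearlyIndependent-resp v≈w ind k eq =
    ind k (≈ᴹ-trans (linearCombination-cong k v≈w) eq)

  coefficients-unique : ∀ {n} {v : Vector Carrierᴹ n} → LinearlyIndependent v →
    ∀ (k k′ : Vector Carrier n) → linearCombination k v ≈ᴹ linearCombination k′ v →
    ∀ i → k i ≈ k′ i
  coefficients-unique {n} {v} ind k k′ eq i =
    x∙y⁻¹≈ε⇒x≈y (k i) (k′ i) (ind (λ j → k j - k′ j) vanishes i)
    where
    open ≈ᴹ-Reasoning
    cancels : linearCombination k′ v +ᴹ linearCombination (λ j → - k′ j) v ≈ᴹ 0ᴹ
    cancels = begin
      linearCombination k′ v +ᴹ linearCombination (λ j → - k′ j) v
        ≈⟨ ∑-distrib-+ (λ j → k′ j *ₗ v j) (λ j → (- k′ j) *ₗ v j) ⟨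
      sum (λ j → k′ j *ₗ v j +ᴹ (- k′ j) *ₗ v j)
        ≈⟨ sum-cong-≋ (λ j → ≈ᴹ-trans (≈ᴹ-sym (*ₗ-distribʳ (v j) (k′ j) (- k′ j)))
                                      (*ₗ-cong (-‿inverseʳ (k′ j)) ≈ᴹ-refl)) ⟩
      sum (λ j → 0# *ₗ v j)
        ≈⟨ zeros v ⟩
      0ᴹ ∎
      where
      zeros : ∀ {m} (u : Vector Carrierᴹ m) → sum (λ j → 0# *ₗ u j) ≈ᴹ 0ᴹ
      zeros {zero}  u = ≈ᴹ-refl
      zeros {suc m} u =
        ≈ᴹ-trans (+ᴹ-cong (*ₗ-zeroˡ (u zero)) (zeros (λ j → u (suc j)))) (+ᴹ-identityˡ 0ᴹ)
    vanishes : linearCombination (λ j → k j - k′ j) v ≈ᴹ 0ᴹ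
    vanishes = begin
      sum (λ j → (k j - k′ j) *ₗ v j)
        ≈⟨ sum-cong-≋ (λ j → *ₗ-distribʳ (v j) (k j) (- k′ j)) ⟩
      sum (λ j → k j *ₗ v j +ᴹ (- k′ j) *ₗ v j)
        ≈⟨ ∑-distrib-+ (λ j → k j *ₗ v j) (λ j → (- k′ j) *ₗ v j) ⟩
      linearCombination k v +ᴹ linearCombination (λ j → - k′ j) v
        ≈⟨ +ᴹ-cong eq ≈ᴹ-refl ⟩
      linearCombination k′ v +ᴹ linearCombination (λ j → - k′ j) v
        ≈⟨ cancels ⟩
      0ᴹ ∎

  HasCoordinates : ∀ {n} → Carrierᴹ → Vector Carrierᴹ n → Set (c ⊔ ℓ)
  HasCoordinates {n} v vs =
    LinearlyIndependent vs × (Σ[ k ∈ Vector Carrier n ] (v ≈ᴹ linearCombination k vs))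

  -- The `no` case covers both default cases of λₙ,ᵢ: if vs is independent and
  -- v is not in its span, then v together with vs is independent.
  coordinate : ∀ {n} {v : Carrierᴹ} {vs : Vector Carrierᴹ n} →
               Dec (HasCoordinates v vs) → Fin n → Carrier
  coordinate (yes (_ , k , _)) i = k i
  coordinate (no _)            i = 0#

  HasCoordinates-resp : ∀ {n} {v w : Carrierᴹ} {vs ws : Vector Carrierᴹ n} →
    v ≈ᴹ w → (∀ i → vs i ≈ᴹ ws i) → HasCoordinates v vs → HasCoordinates w ws
  HasCoordinates-resp p ps (ind , k , eq) =
    LinearlyIndependent-resp ps ind , k ,
    ≈ᴹ-trans (≈ᴹ-sym p) (≈ᴹ-trans eq (linearCombination-cong k ps))

  coordinate-cong : ∀ {n} {v w : Carrierᴹ} {vs ws : Vector Carrierᴹ n}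
    (d : Dec (HasCoordinates v vs)) (e : Dec (HasCoordinates w ws)) →
    v ≈ᴹ w → (∀ i → vs i ≈ᴹ ws i) → ∀ i → coordinate d i ≈ coordinate e i
  coordinate-cong (yes (ind , k , eq)) (yes (_ , k′ , eq′)) p ps =
    coefficients-unique ind k k′
      (≈ᴹ-trans (≈ᴹ-sym eq) (≈ᴹ-trans p (≈ᴹ-trans eq′
        (linearCombination-cong k′ (λ j → ≈ᴹ-sym (ps j))))))
  coordinate-cong (yes h) (no ¬h) p ps i =
    contradiction (HasCoordinates-resp p ps h) ¬h
  coordinate-cong (no ¬h) (yes h) p ps i =
    contradiction (HasCoordinates-resp (≈ᴹ-sym p) (λ j → ≈ᴹ-sym (ps j)) h) ¬h
  coordinate-cong (no _) (no _) p ps i = refl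

  -- Excluded middle is what makes λₙ,ᵢ a total function.
  vectorSpaceStructureWλ : ExcludedMiddle (c ⊔ ℓ) → Structure vectorSpaceLanguageWλ c ℓ
  vectorSpaceStructureWλ em = record
    { domain   = VDomain
    ; ⟦_⟧ᶠ     = λ { (base f) xs         → ⟦ f ⟧ⱽ xs
                   ; (coef n i) (v ∷ vs) →
                       coordinate (em {P = HasCoordinates v (toVector n vs)}) i }
    ; ⟦⟧ᶠ-cong = λ { (base f) p → ⟦⟧ⱽ-cong f p
                   ; (coef n i) {v ∷ vs} {w ∷ ws} (p , ps) →
                       coordinate-cong em em p (toVector-cong n ps) i }
    ; ⟦_⟧ʳ     = λ { (W n) vs → LinearlyIndependent (toVector n vs) }
    ; ⟦⟧ʳ-resp = λ { (W n) {vs} {ws} ps →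
                       LinearlyIndependent-resp (toVector-cong n ps) }
    }

-- Interpretations transfer NIP, because codes of the parameters and the
-- parameters of the defining formulas can be absorbed into the parameter
-- tuple of a formula.  This reduces everything to: if K is NIP, so is V.
--
-- Relative to an independent tuple w, a formula about vectors in the span of w
-- becomes a field formula about their coordinates, depending only on the
-- length of w.  If V has a finite basis this is enough.  Otherwise coordinates
-- with respect to a bounded number of vectors must be arranged.  Let a₁, a₂, …
-- be shattered, with aᵢ spanned by C and r vectors eᵢ.  If enough of the eᵢ are
-- jointly independent over C, then any parameter tuple b depends on at most
-- |b| blocks of them, so on some block the traces are cut out by one field
-- formula in the coordinates over eᵢ, b and C, and NIP of K applies.  If not,
-- adjoining boundedly many vectors to C lets one lower r.

module Submission where

open import Defs
open import Level using (Level; _⊔_; Lift; lift; lower) renaming (suc to lsuc)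
open import Algebra.Module.Bundles using (LeftModule)
import Algebra.Properties.AbelianGroup as AbelianGroupProperties
import Algebra.Properties.CommutativeMonoid.Sum as CommutativeMonoidSum
open import Axiom.DoubleNegationElimination using (em⇒dne)
open import Axiom.ExcludedMiddle using (ExcludedMiddle)
open import Data.Bool.Base using (Bool; true; false)
import Data.Empty as Empty
import Data.Empty.Polymorphic as Polymorphic
open import Data.Fin.Base using (Fin; zero; suc; combine; remQuot)
open import Data.Fin.Properties using (remQuot-combine)
open import Data.List.Base using (List; []; _∷_; _++_; concat; concatMap; length; replicate; tabulate)
open import Data.List.Membership.Propositional using (_∈_)
open import Data.List.Membership.Propositional.Properties using (∈-tabulate⁻)
open import Data.List.Properties using (++-assoc; length-++; length-tabulate)
open import Data.List.Relation.Unary.All as All using (All; []; _∷_)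
open import Data.List.Relation.Unary.All.Properties
  using (++⁺; ++⁻ˡ; ++⁻ʳ; map⁻; concat⁻; map-∘; map-cong; map-id; lookup-map)
open import Data.List.Relation.Unary.Any using (here; there)
open import Data.Nat.Base as ℕ using (ℕ; zero; suc)
import Data.Nat.Properties as ℕ
open import Data.Product.Base using (Σ-syntax; ∃-syntax; _×_; _,_; proj₁; proj₂)
open import Data.Sum.Base using (_⊎_; inj₁; inj₂)
import Data.Unit.Base as Unit
open import Data.Unit.Polymorphic using (⊤; tt)
import Data.Vec.Base as Vec
open import Data.Vec.Functional using (Vector)
open import Data.Vec.Properties using ([]=⇒lookup; lookup⇒[]=; lookup∘tabulate)
open import Function.Base using (_∘_; id)
open import Function.Bundles using (_⇔_; mk⇔; Equivalence)
open import Function.Construct.Composition using (_⇔-∘_)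
open import Function.Construct.Identity using (⇔-id)
open import Function.Construct.Symmetry using (⇔-sym)
open import Relation.Binary.Bundles using (Setoid)
open import Relation.Binary.PropositionalEquality.Core as ≡
  using (_≡_; refl; cong; cong₂; subst)
open import Relation.Nullary using (¬_; Dec; yes; no; contradiction)

open Equivalence using (to; from)

-- The obstacle in infinite dimension is that a list spanning both `a i` and a parameter tuple
-- depends on both, while NIP of the field applies only if the coordinates of `a i` do not change
-- with the parameters and those of the parameters do not change with `i`. Frames `e i ++ f ++ ws`,
-- with `e i` made for `a i` and `f` for the parameters, have this property, provided that they are
-- independent. To force independence, `length Δ + 1` blocks are used. On each block some set is not
-- cut out by any parameters in general position to it. If one parameter tuple cut out all these
-- sets at once, it would fail to be in general position to every block, whereas `length Δ` new
-- vectors can spoil at most `length Δ` blocks. All bounds depend on lengths only: the length of the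
-- pieces, of the base and of the parameter tuple. Hence finite shattered families in V itself
-- suffice, and no elementary extension has to be taken. It also explains why bases and pieces are
-- repeatedly padded or trimmed to exact lengths.

≡⇒⇔ : ∀ {a} {A B : Set a} → A ≡ B → A ⇔ B
≡⇒⇔ refl = ⇔-id _

⇔-imp : ∀ {a b c d} {A : Set a} {B : Set b} {C : Set c} {D : Set d} →
        A ⇔ B → C ⇔ D → (A → C) ⇔ (B → D)
⇔-imp p q = mk⇔ (λ f → to q ∘ f ∘ from p) (λ f → from q ∘ f ∘ to p)

⇔-all : ∀ {a b c} {A : Set a} {B : A → Set b} {C : A → Set c} →
        (∀ x → B x ⇔ C x) → (∀ x → B x) ⇔ (∀ x → C x)
⇔-all p = mk⇔ (λ f x → to (p x) (f x)) (λ f x → from (p x) (f x))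

-- Tuples

module _ {a} {A : Set a} where

  -- A tuple of variables doubles as a renaming and as a selection from an assignment; the handling
  -- of contexts below rests on this.
  values : ∀ {p} {P : A → Set p} {Γ Θ : List A} → All P Θ → All (_∈ Θ) Γ → All P Γ
  values ρ = All.map (All.lookup ρ)

  vars : ∀ (Γ : List A) → All (_∈ Γ) Γ
  vars []      = []
  vars (s ∷ Γ) = here refl ∷ All.map there (vars Γ)

  inˡ : ∀ (Γ : List A) {Δ : List A} → All (_∈ Γ ++ Δ) Γ
  inˡ []      = []
  inˡ (s ∷ Γ) = here refl ∷ All.map there (inˡ Γ)

  weaken : ∀ (Γ : List A) {Δ Θ : List A} → All (_∈ Δ) Θ → All (_∈ Γ ++ Δ) Θ
  weaken []      vs = vs
  weaken (s ∷ Γ) vs = All.map there (weaken Γ vs)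

  module _ {p} {P : A → Set p} where

    values-there : ∀ {s} {Γ Θ : List A} {x : P s} {ρ : All P Θ} (vs : All (_∈ Θ) Γ) →
                   values (x ∷ ρ) (All.map there vs) ≡ values ρ vs
    values-there vs = map-∘ vs

    values-vars : ∀ {Γ : List A} (ρ : All P Γ) → values ρ (vars Γ) ≡ ρ
    values-vars []      = refl
    values-vars (x ∷ ρ) = cong (x ∷_) (≡.trans (values-there (vars _)) (values-vars ρ))

    values-inˡ : ∀ {Γ Δ : List A} (xs : All P Γ) (ρ : All P Δ) → values (++⁺ xs ρ) (inˡ Γ) ≡ xs
    values-inˡ []       ρ = refl
    values-inˡ (x ∷ xs) ρ = cong (x ∷_) (≡.trans (values-there (inˡ _)) (values-inˡ xs ρ))

    values-weaken : ∀ {Γ Δ Θ : List A} (xs : All P Γ) (ρ : All P Δ) (vs : All (_∈ Δ) Θ) →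
                    values (++⁺ xs ρ) (weaken Γ vs) ≡ values ρ vs
    values-weaken []       ρ vs = refl
    values-weaken (x ∷ xs) ρ vs =
      ≡.trans (values-there (weaken _ vs)) (values-weaken xs ρ vs)

    values-inʳ : ∀ {Γ Δ : List A} (xs : All P Γ) (ρ : All P Δ) →
                 values (++⁺ xs ρ) (weaken Γ (vars Δ)) ≡ ρ
    values-inʳ xs ρ = ≡.trans (values-weaken xs ρ (vars _)) (values-vars ρ)

    ++⁻ˡ-++⁺ : ∀ {Γ Δ : List A} (xs : All P Γ) (ys : All P Δ) → ++⁻ˡ Γ (++⁺ xs ys) ≡ xs
    ++⁻ˡ-++⁺ []       ys = refl
    ++⁻ˡ-++⁺ (x ∷ xs) ys = cong (x ∷_) (++⁻ˡ-++⁺ xs ys)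

    ++⁻ʳ-++⁺ : ∀ {Γ Δ : List A} (xs : All P Γ) (ys : All P Δ) → ++⁻ʳ Γ (++⁺ xs ys) ≡ ys
    ++⁻ʳ-++⁺ []       ys = refl
    ++⁻ʳ-++⁺ (x ∷ xs) ys = ++⁻ʳ-++⁺ xs ys

  module _ {p q} {P : A → Set p} {Q : A → Set q} (f : ∀ {s} → P s → Q s) where

    map-values : ∀ {Γ Θ : List A} (ρ : All P Θ) (vs : All (_∈ Θ) Γ) →
                 All.map f (values ρ vs) ≡ values (All.map f ρ) vs
    map-values ρ []       = refl
    map-values ρ (v ∷ vs) = cong₂ _∷_ (≡.sym (lookup-map ρ v)) (map-values ρ vs)

    map-++⁺ : ∀ {Γ Δ : List A} (xs : All P Γ) (ys : All P Δ) →
              All.map f (++⁺ xs ys) ≡ ++⁺ (All.map f xs) (All.map f ys)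
    map-++⁺ []       ys = refl
    map-++⁺ (x ∷ xs) ys = cong (f x ∷_) (map-++⁺ xs ys)

    map-++⁻ˡ : ∀ (Γ : List A) {Δ : List A} (xs : All P (Γ ++ Δ)) → All.map f (++⁻ˡ Γ xs) ≡ ++⁻ˡ Γ (All.map f xs)
    map-++⁻ˡ []      xs       = refl
    map-++⁻ˡ (s ∷ Γ) (x ∷ xs) = cong (f x ∷_) (map-++⁻ˡ Γ xs)

    map-++⁻ʳ : ∀ (Γ : List A) {Δ : List A} (xs : All P (Γ ++ Δ)) → All.map f (++⁻ʳ Γ xs) ≡ ++⁻ʳ Γ (All.map f xs)
    map-++⁻ʳ []      xs       = refl
    map-++⁻ʳ (s ∷ Γ) (x ∷ xs) = map-++⁻ʳ Γ xs

  module _ {p q r} {P : A → Set p} {Q : A → Set q} {R : ∀ {s} → P s → Q s → Set r} where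

    pointwise-lookup : ∀ {Γ : List A} {s} (xs : All P Γ) (ys : All Q Γ) → Pointwise R xs ys →
                       (v : s ∈ Γ) → R (All.lookup xs v) (All.lookup ys v)
    pointwise-lookup (x ∷ xs) (y ∷ ys) (r , rs) (here refl) = r
    pointwise-lookup (x ∷ xs) (y ∷ ys) (r , rs) (there v)   = pointwise-lookup xs ys rs v

    pointwise-values : ∀ {Γ Θ : List A} (xs : All P Θ) (ys : All Q Θ) → Pointwise R xs ys →
                       (vs : All (_∈ Θ) Γ) → Pointwise R (values xs vs) (values ys vs)
    pointwise-values xs ys rs []       = tt
    pointwise-values xs ys rs (v ∷ vs) =
      pointwise-lookup xs ys rs v , pointwise-values xs ys rs vs

    pointwise-++ : ∀ {Γ Δ : List A} (xs : All P Γ) (ys : All Q Γ) {xs′ : All P Δ} {ys′ : All Q Δ} →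
                   Pointwise R xs ys → Pointwise R xs′ ys′ →
                   Pointwise R (++⁺ xs xs′) (++⁺ ys ys′)
    pointwise-++ []       []       _        rs′ = rs′
    pointwise-++ (x ∷ xs) (y ∷ ys) (r , rs) rs′ = r , pointwise-++ xs ys rs rs′

    pointwise-choice : (∀ {s} (y : Q s) → ∃[ x ] R x y) →
                       ∀ {Γ : List A} (ys : All Q Γ) → ∃[ xs ] Pointwise R {Γ} xs ys
    pointwise-choice f []       = [] , tt
    pointwise-choice f (y ∷ ys) with f y | pointwise-choice f ys
    ... | x , r | xs , rs = x ∷ xs , r , rs

module _ {a b} {A : Set a} {B : Set b} (dim : B → List A) where

  -- The same regrouping as in `Preimage`, so that interpretations fit without conversion.
  group : ∀ {p} {P : A → Set p} {Γ : List B} → All P (concatMap dim Γ) → All (λ s → All P (dim s)) Γ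
  group = map⁻ ∘ concat⁻

  flatten : ∀ {p} {P : A → Set p} {Γ : List B} → All (λ s → All P (dim s)) Γ → All P (concatMap dim Γ)
  flatten []         = []
  flatten (xs ∷ xss) = ++⁺ xs (flatten xss)

  group-flatten : ∀ {p} {P : A → Set p} {Γ : List B} (xss : All (λ s → All P (dim s)) Γ) →
                  group (flatten xss) ≡ xss
  group-flatten []         = refl
  group-flatten (xs ∷ xss) = cong₂ _∷_ (++⁻ˡ-++⁺ xs (flatten xss))
    (≡.trans (cong group (++⁻ʳ-++⁺ xs (flatten xss))) (group-flatten xss))

  module _ {p q} {P : A → Set p} {Q : A → Set q} (f : ∀ {s} → P s → Q s) where

    map-group : ∀ {Γ : List B} (xs : All P (concatMap dim Γ)) →
                All.map (All.map f) (group {Γ = Γ} xs) ≡ group {Γ = Γ} (All.map f xs)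
    map-group {[]}    []  = refl
    map-group {s ∷ Γ} xs  = cong₂ _∷_ (map-++⁻ˡ f (dim s) xs)
      (≡.trans (map-group {Γ} (++⁻ʳ (dim s) xs)) (cong (group {Γ = Γ}) (map-++⁻ʳ f (dim s) xs)))

    map-flatten : ∀ {Γ : List B} (xss : All (λ s → All P (dim s)) Γ) →
                  All.map f (flatten xss) ≡ flatten (All.map (All.map f) xss)
    map-flatten []         = refl
    map-flatten (xs ∷ xss) =
      ≡.trans (map-++⁺ f xs (flatten xss)) (cong (++⁺ (All.map f xs)) (map-flatten xss))

  group-values : ∀ {p} {P : A → Set p} {Γ : List B} {Θ : List A} (ρ : All P Θ)
                 (vs : All (_∈ Θ) (concatMap dim Γ)) (xss : All (λ s → All P (dim s)) Γ) →
                 values ρ vs ≡ flatten xss → All.map (values ρ) (group {Γ = Γ} vs) ≡ xss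
  group-values {Γ = Γ} ρ vs xss eq = ≡.trans (map-group _ {Γ} vs)
    (≡.trans (cong (group {Γ = Γ}) eq) (group-flatten xss))

-- Formulas

module _ {l} {L : Language l} where
  open Language L

  mutual
    renameTerm : ∀ {Γ Θ s} → All (_∈ Θ) Γ → Term L Γ s → Term L Θ s
    renameTerm vs (var x)     = var (All.lookup vs x)
    renameTerm vs (func f ts) = func f (renameTerms vs ts)

    renameTerms : ∀ {Γ Θ ss} → All (_∈ Θ) Γ → All (Term L Γ) ss → All (Term L Θ) ss
    renameTerms vs []       = []
    renameTerms vs (t ∷ ts) = renameTerm vs t ∷ renameTerms vs ts

  rename : ∀ {Γ Θ} → All (_∈ Θ) Γ → Formula L Γ → Formula L Θ
  rename vs falsum      = falsum
  rename vs (equal t u) = equal (renameTerm vs t) (renameTerm vs u)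
  rename vs (rel R ts)  = rel R (renameTerms vs ts)
  rename vs (imp φ ψ)   = imp (rename vs φ) (rename vs ψ)
  rename vs (all s φ)   = all s (rename (here refl ∷ All.map there vs) φ)

  neg : ∀ {Γ} → Formula L Γ → Formula L Γ
  neg φ = imp φ falsum

  conj : ∀ {Γ} → Formula L Γ → Formula L Γ → Formula L Γ
  conj φ ψ = neg (imp φ (neg ψ))

  alls : ∀ Γ {Θ} → Formula L (Γ ++ Θ) → Formula L Θ
  alls []      φ = φ
  alls (s ∷ Γ) φ = alls Γ (all s φ)

  module _ {c ℓ} (M : Structure L c ℓ) where
    open Structure M using (Tuple; Elem)

    mutual
      eval-rename : ∀ {Γ Θ s} (ρ : Tuple Θ) (vs : All (_∈ Θ) Γ) (t : Term L Γ s) →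
                    eval M ρ (renameTerm vs t) ≡ eval M (values ρ vs) t
      eval-rename ρ vs (var x)     = ≡.sym (lookup-map vs x)
      eval-rename ρ vs (func f ts) = cong (Structure.⟦_⟧ᶠ M f) (evals-rename ρ vs ts)

      evals-rename : ∀ {Γ Θ ss} (ρ : Tuple Θ) (vs : All (_∈ Θ) Γ) (ts : All (Term L Γ) ss) →
                     evals M ρ (renameTerms vs ts) ≡ evals M (values ρ vs) ts
      evals-rename ρ vs []       = refl
      evals-rename ρ vs (t ∷ ts) = cong₂ _∷_ (eval-rename ρ vs t) (evals-rename ρ vs ts)

    sat-≡ : ∀ {Γ} (φ : Formula L Γ) {ρ σ : Tuple Γ} → ρ ≡ σ → M ⊨ φ [ ρ ] ⇔ M ⊨ φ [ σ ]
    sat-≡ φ refl = ⇔-id _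

    sat-rename : ∀ {Γ Θ} (ρ : Tuple Θ) (vs : All (_∈ Θ) Γ) (φ : Formula L Γ) →
                 M ⊨ rename vs φ [ ρ ] ⇔ M ⊨ φ [ values ρ vs ]
    sat-rename ρ vs falsum = ⇔-id _
    sat-rename ρ vs (equal t u)
      rewrite eval-rename ρ vs t | eval-rename ρ vs u = ⇔-id _
    sat-rename ρ vs (rel R ts) rewrite evals-rename ρ vs ts = ⇔-id _
    sat-rename ρ vs (imp φ ψ) = ⇔-imp (sat-rename ρ vs φ) (sat-rename ρ vs ψ)
    sat-rename ρ vs (all s φ) = ⇔-all λ x →
      sat-≡ φ (cong (x ∷_) (values-there vs))
        ⇔-∘ sat-rename (x ∷ ρ) (here refl ∷ All.map there vs) φ

    sat-alls : ∀ Γ {Θ} (φ : Formula L (Γ ++ Θ)) (ρ : Tuple Θ) →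
               M ⊨ alls Γ φ [ ρ ] ⇔ (∀ xs → M ⊨ φ [ ++⁺ xs ρ ])
    sat-alls []      φ ρ = mk⇔ (λ { h [] → h }) (λ h → h [])
    sat-alls (s ∷ Γ) φ ρ =
      mk⇔ (λ { h (x ∷ xs) → h xs x }) (λ h xs x → h (x ∷ xs)) ⇔-∘ sat-alls Γ (all s φ) ρ

    -- Excluded middle enters because conjunction abbreviates a formula in implication and falsity.
    sat-conj : (∀ {a} → ExcludedMiddle a) → ∀ {Γ} (φ ψ : Formula L Γ) {ρ} →
               M ⊨ conj φ ψ [ ρ ] ⇔ (M ⊨ φ [ ρ ] × M ⊨ ψ [ ρ ])
    sat-conj em φ ψ = mk⇔
      (λ h → em⇒dne em (λ n → lower (h (λ p q → lift (n (p , q))))))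
      (λ { (p , q) h → h p q })

-- Transfer of NIP along codings

module _ {l c ℓ} {L : Language l} (M : Structure L c ℓ) where
  open Structure M

  ≈*-refl : ∀ {ss} (xs : Tuple ss) → xs ≈* xs
  ≈*-refl []       = tt
  ≈*-refl (x ∷ xs) = Setoid.refl (domain _) , ≈*-refl xs

  ≈*-sym : ∀ {ss} (xs ys : Tuple ss) → xs ≈* ys → ys ≈* xs
  ≈*-sym []       []       _        = tt
  ≈*-sym (x ∷ xs) (y ∷ ys) (e , es) = Setoid.sym (domain _) e , ≈*-sym xs ys es

  mutual
    eval-cong : ∀ {Γ s} (ρ σ : Tuple Γ) → ρ ≈* σ → (t : Term L Γ s) → eval M ρ t ≈ eval M σ t
    eval-cong ρ σ e (var x)     = pointwise-lookup ρ σ e x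
    eval-cong ρ σ e (func f ts) = ⟦⟧ᶠ-cong f (evals-cong ρ σ e ts)

    evals-cong : ∀ {Γ ss} (ρ σ : Tuple Γ) → ρ ≈* σ → (ts : All (Term L Γ) ss) →
                 evals M ρ ts ≈* evals M σ ts
    evals-cong ρ σ e []       = tt
    evals-cong ρ σ e (t ∷ ts) = eval-cong ρ σ e t , evals-cong ρ σ e ts

  graph-resp : ∀ {ss s} (f : Language.Func L ss s) (xs ys : Tuple (s ∷ ss)) →
               xs ≈* ys → graph f xs → graph f ys
  graph-resp f (x ∷ xs) (y ∷ ys) (e , es) p = Setoid.trans (domain _)
    (⟦⟧ᶠ-cong f (≈*-sym xs ys es)) (Setoid.trans (domain _) p e)

  equality-resp : ∀ {s} (xs ys : Tuple (s ∷ s ∷ [])) → xs ≈* ys → equality xs → equality ys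
  equality-resp (x ∷ x′ ∷ []) (y ∷ y′ ∷ []) (e , e′ , _) p = Setoid.trans (domain _)
    (Setoid.sym (domain _) e) (Setoid.trans (domain _) p e′)

module _ {l c ℓ l′ c′ ℓ′ r : Level} {L : Language l} {L′ : Language l′}
         (N : Structure L′ c′ ℓ′) (M : Structure L c ℓ) where
  private
    module L = Language L
    module L′ = Language L′
    module M = Structure M
    module N = Structure N

  -- Less than an `Interpretation`: an element may have many codes, and nothing is required of the
  -- codes of equal elements. The consistency that is needed sits in the `correct` fields below,
  -- which speak of all codes.
  record Representation : Set (l ⊔ l′ ⊔ c ⊔ c′ ⊔ lsuc r) where
    field
      dim        : L′.Sort → List L.Sort
      Represents : ∀ {s} → M.Tuple (dim s) → N.Elem s → Set r
      surjective : ∀ {s} (a : N.Elem s) → ∃[ x ] Represents x a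

  module _ (R : Representation) where
    open Representation R

    Env : List L.Sort → List L′.Sort → Set (l ⊔ l′)
    Env Θ = All (λ s → All (_∈ Θ) (dim s))

    -- The formula can be placed in any context with variables for the codes
    -- and for the parameters, which replaces substitution into formulas.
    -- On tuples that are not codes its truth value is arbitrary.
    record Def {p Γ} (P : N.Tuple Γ → Set p) : Set (l ⊔ l′ ⊔ c ⊔ ℓ ⊔ c′ ⊔ r ⊔ p) where
      field
        Π       : List L.Sort
        params  : M.Tuple Π
        form    : ∀ {Θ} → Env Θ Γ → All (_∈ Θ) Π → Formula L Θ
        correct : ∀ {Θ} (env : Env Θ Γ) π (ρ : M.Tuple Θ) as → values ρ π ≡ params →
                  Pointwise Represents (All.map (values ρ) env) as →
                  P as ⇔ M ⊨ form env π [ ρ ]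

    -- The formula of a `Def` is unconstrained off the codes, so a quantifier over `s` must be
    -- relativized to tuples that are codes; this supplies the guard.
    record DomainDef (s : L′.Sort) : Set (l ⊔ l′ ⊔ c ⊔ ℓ ⊔ c′ ⊔ r) where
      field
        Π       : List L.Sort
        params  : M.Tuple Π
        form    : ∀ {Θ} → All (_∈ Θ) (dim s) → All (_∈ Θ) Π → Formula L Θ
        correct : ∀ {Θ} (xs : All (_∈ Θ) (dim s)) π (ρ : M.Tuple Θ) → values ρ π ≡ params →
                  (∃[ a ] Represents (values ρ xs) a) ⇔ M ⊨ form xs π [ ρ ]

    open Def

    def-⇔ : ∀ {p q Γ} {P : N.Tuple Γ → Set p} {Q : N.Tuple Γ → Set q} →
            (∀ as → Q as ⇔ P as) → Def P → Def Q
    def-⇔ e P = record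
      { Π = P .Π ; params = P .params ; form = P .form
      ; correct = λ env π ρ as eq rs → P .correct env π ρ as eq rs ⇔-∘ e as }

    def-falsum : ∀ {p Γ} → Def {Γ = Γ} (λ _ → Polymorphic.⊥ {p})
    def-falsum = record
      { Π = [] ; params = [] ; form = λ _ _ → falsum
      ; correct = λ _ _ _ _ _ _ → mk⇔ (λ ()) (λ ()) }

    def-reindex : ∀ {p Γ Δ} {P : N.Tuple Γ → Set p} (vs : All (_∈ Δ) Γ) →
                  Def P → Def (λ as → P (values as vs))
    def-reindex vs P = record
      { Π = P .Π ; params = P .params ; form = λ env → P .form (values env vs)
      ; correct = λ env π ρ as eq rs → P .correct (values env vs) π ρ (values as vs) eq
          (subst (λ xs → Pointwise Represents xs (values as vs))
            (≡.sym (map-values (values ρ) env vs))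
            (pointwise-values (All.map (values ρ) env) as rs vs)) }

    def-imp : ∀ {p q Γ} {P : N.Tuple Γ → Set p} {Q : N.Tuple Γ → Set q} →
              Def P → Def Q → Def (λ as → P as → Q as)
    def-imp P Q = record
      { Π = P .Π ++ Q .Π
      ; params = ++⁺ (P .params) (Q .params)
      ; form = λ env π → imp (P .form env (++⁻ˡ (P .Π) π)) (Q .form env (++⁻ʳ (P .Π) π))
      ; correct = λ env π ρ as eq rs → ⇔-imp
          (P .correct env (++⁻ˡ (P .Π) π) ρ as (split-paramsˡ ρ π eq) rs)
          (Q .correct env (++⁻ʳ (P .Π) π) ρ as (split-paramsʳ ρ π eq) rs) }
      where
      split-paramsˡ : ∀ {Π₁ Π₂ Θ b₁ b₂} (ρ : M.Tuple Θ) (π : All (_∈ Θ) (Π₁ ++ Π₂)) →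
                      values ρ π ≡ ++⁺ {xs = Π₁} b₁ b₂ → values ρ (++⁻ˡ Π₁ π) ≡ b₁
      split-paramsˡ {b₁ = b₁} {b₂} ρ π eq = ≡.trans (map-++⁻ˡ _ _ π)
        (≡.trans (cong (++⁻ˡ _) eq) (++⁻ˡ-++⁺ b₁ b₂))
      split-paramsʳ : ∀ {Π₁ Π₂ Θ b₁ b₂} (ρ : M.Tuple Θ) (π : All (_∈ Θ) (Π₁ ++ Π₂)) →
                      values ρ π ≡ ++⁺ {xs = Π₁} b₁ b₂ → values ρ (++⁻ʳ Π₁ π) ≡ b₂
      split-paramsʳ {b₁ = b₁} {b₂} ρ π eq = ≡.trans (map-++⁻ʳ _ _ π)
        (≡.trans (cong (++⁻ʳ _) eq) (++⁻ʳ-++⁺ b₁ b₂))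

    -- A tuple passing the guard codes some element, and by `surjective` every element has such a
    -- tuple, so the relativized block of quantifiers ranges over exactly the elements of `s`.
    def-all : ∀ {p s Γ} {P : N.Tuple (s ∷ Γ) → Set p} → DomainDef s → Def P →
              Def (λ as → ∀ a → P (a ∷ as))
    def-all {s = s} {Γ} {P} D Q = record
      { Π = D.Π ++ Q .Π
      ; params = ++⁺ D.params (Q .params)
      ; form = λ env π → alls (dim s) (body env π)
      ; correct = λ env π ρ as eq rs → ⇔-sym (sat-alls M (dim s) (body env π) ρ) ⇔-∘ mk⇔
          (λ h xs → from (correct-body env π ρ xs eq) λ { (a , r) →
             to (correct-Q env π ρ xs a as eq r rs) (h a) })
          (λ h a → let x , r = surjective a in
             from (correct-Q env π ρ x a as eq r rs)
               (to (correct-body env π ρ x eq) (h x) (a , r)))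
      }
      where
      module D = DomainDef D
      new : ∀ {Θ} → All (_∈ dim s ++ Θ) (dim s)
      new = inˡ (dim s)
      πᴰ : ∀ {Θ} → All (_∈ Θ) (D.Π ++ Q .Π) → All (_∈ dim s ++ Θ) D.Π
      πᴰ π = weaken (dim s) (++⁻ˡ D.Π π)
      πᴼ : ∀ {Θ} → All (_∈ Θ) (D.Π ++ Q .Π) → All (_∈ dim s ++ Θ) (Q .Π)
      πᴼ π = weaken (dim s) (++⁻ʳ D.Π π)
      env⁺ : ∀ {Θ} → Env Θ Γ → Env (dim s ++ Θ) (s ∷ Γ)
      env⁺ env = new ∷ All.map (weaken (dim s)) env
      body : ∀ {Θ} → Env Θ Γ → All (_∈ Θ) (D.Π ++ Q .Π) → Formula L (dim s ++ Θ)
      body env π = imp (D.form new (πᴰ π)) (Q .form (env⁺ env) (πᴼ π))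
      correct-Q : ∀ {Θ} env π (ρ : M.Tuple Θ) x a as → values ρ π ≡ ++⁺ D.params (Q .params) →
                  Represents x a → Pointwise Represents (All.map (values ρ) env) as →
                  P (a ∷ as) ⇔ M ⊨ Q .form (env⁺ env) (πᴼ π) [ ++⁺ x ρ ]
      correct-Q env π ρ x a as eq r rs = Q .correct (env⁺ env) (πᴼ π) (++⁺ x ρ) (a ∷ as)
        (≡.trans (values-weaken x ρ _) (≡.trans (map-++⁻ʳ _ D.Π π)
          (≡.trans (cong (++⁻ʳ D.Π) eq) (++⁻ʳ-++⁺ D.params (Q .params)))))
        ( subst (λ y → Represents y a) (≡.sym (values-inˡ x ρ)) r
        , subst (λ ys → Pointwise Represents ys as)
            (≡.sym (≡.trans (map-∘ env) (map-cong env (values-weaken x ρ)))) rs )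
      correct-body : ∀ {Θ} env π (ρ : M.Tuple Θ) x → values ρ π ≡ ++⁺ D.params (Q .params) →
                     M ⊨ body env π [ ++⁺ x ρ ] ⇔
                     (∃[ a ] Represents x a → M ⊨ Q .form (env⁺ env) (πᴼ π) [ ++⁺ x ρ ])
      correct-body env π ρ x eq = ⇔-imp (⇔-sym
        (subst (λ y → (∃[ a ] Represents y a) ⇔ M ⊨ D.form new (πᴰ π) [ ++⁺ x ρ ]) (values-inˡ x ρ)
          (D.correct new (πᴰ π) (++⁺ x ρ)
            (≡.trans (values-weaken x ρ _) (≡.trans (map-++⁻ˡ _ D.Π π)
              (≡.trans (cong (++⁻ˡ D.Π) eq) (++⁻ˡ-++⁺ D.params (Q .params)))))))) (⇔-id _)

  record Coding : Set (lsuc (l ⊔ l′ ⊔ c ⊔ c′ ⊔ ℓ ⊔ ℓ′ ⊔ r)) where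
    field
      representation : Representation
    field
      domain-def   : ∀ s → DomainDef representation s
      equality-def : ∀ s → Def representation (N.equality {s})
      graph-def    : ∀ {ss s} (f : L′.Func ss s) → Def representation (N.graph f)
      relation-def : ∀ {ss} (R : L′.Rel ss) → Def representation N.⟦ R ⟧ʳ

  module _ (C : Coding) where
    open Coding C
    open Representation representation
    open Def

    Respectful : ∀ {p Γ} → (N.Tuple Γ → Set p) → Set (l′ ⊔ c′ ⊔ ℓ′ ⊔ p)
    Respectful P = ∀ as bs → as N.≈* bs → P as → P bs

    -- Terms of N need not be terms of M, so they are substituted into a
    -- predicate by quantifying over their values.
    termGraph : ∀ {Γ s} → Term L′ Γ s → N.Tuple (s ∷ Γ) → Set ℓ′
    termGraph t (a ∷ as) = eval N as t N.≈ a

    mutual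
      def-term : ∀ {Γ s} (t : Term L′ Γ s) → Def representation (termGraph t)
      def-term (var x) = def-⇔ representation (λ { (a ∷ as) → ⇔-id _ })
        (def-reindex representation (there x ∷ here refl ∷ []) (equality-def _))
      def-term {Γ} {s} (func {ss} f ts) = def-⇔ representation
        (λ { (a ∷ as) → mk⇔ (subst (N.graph f) (gvars-values a as))
                            (subst (N.graph f) (≡.sym (gvars-values a as))) })
        -- The context is `s ∷ Γ`: the prospective value `a` stands in front of the variables of
        -- `ts`, and `gvars` moves it to the head position that `graph` expects.
        (def-evals ts (All.map there (vars Γ)) (λ xs → N.graph f (values xs gvars))
          (λ as bs e → graph-resp N f _ _ (pointwise-values as bs e gvars))
          (def-reindex representation gvars (graph-def f)))
        where
        gvars : All (_∈ ss ++ s ∷ Γ) (s ∷ ss)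
        gvars = All.lookup (weaken ss (vars (s ∷ Γ))) (here refl) ∷ inˡ ss
        gvars-values : ∀ a as → a ∷ evals N as ts ≡
          values (++⁺ (evals N (values (a ∷ as) (All.map there (vars Γ))) ts) (a ∷ as)) gvars
        gvars-values a as
          rewrite ≡.trans (values-there {x = a} {ρ = as} (vars Γ)) (values-vars as) =
          ≡.sym (cong₂ _∷_
            (≡.trans (≡.sym (lookup-map (weaken ss (vars (s ∷ Γ))) (here refl)))
              (cong (λ zs → All.lookup zs (here refl)) (values-inʳ (evals N as ts) (a ∷ as))))
            (values-inˡ (evals N as ts) (a ∷ as)))

      -- One term is removed at a time: P(t) holds iff P(b) for all b equal to t, because P respects
      -- equality. The universal form is convenient since it is a primitive of formulas. It respects
      -- equality again, so the remaining terms can be treated with it as the predicate.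
      def-evals : ∀ {p Γ Δ ss} (ts : All (Term L′ Γ) ss) (vs : All (_∈ Δ) Γ)
                  (P : N.Tuple (ss ++ Δ) → Set p) → Respectful P → Def representation P →
                  Def representation (λ as → P (++⁺ (evals N (values as vs) ts) as))
      def-evals [] vs P _ D = D
      def-evals {Γ = Γ} {Δ} {s ∷ ss} (t ∷ ts) vs P P-resp D = def-⇔ representation
        (λ as → mk⇔
          (λ p b e → P-resp _ _ (subst (λ ρ → eval N ρ t N.≈ b) (us-values as) e , ≈*-refl N _) p)
          (λ h → h _ (subst (λ ρ → eval N ρ t N.≈ eval N (values as vs) t)
                            (≡.sym (us-values as)) (Setoid.refl (N.domain s)))))
        (def-evals ts vs Q
          (λ as bs e h b e′ → P-resp _ _ (Setoid.refl (N.domain s) , e)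
            (h b (Setoid.trans (N.domain s)
              (eval-cong N _ _ (pointwise-values as bs e us) t) e′)))
          Q-def)
        where
        us : All (_∈ ss ++ Δ) Γ
        us = weaken ss vs
        us-values : ∀ as → values (++⁺ (evals N (values as vs) ts) as) us ≡ values as vs
        us-values as = values-weaken (evals N (values as vs) ts) as vs
        Q : N.Tuple (ss ++ Δ) → Set _
        Q bs = ∀ b → eval N (values bs us) t N.≈ b → P (b ∷ bs)
        T : N.Tuple (s ∷ ss ++ Δ) → Set _
        T (b ∷ bs) = eval N (values bs us) t N.≈ b
        T-def : Def representation T
        T-def = def-⇔ representation
          (λ { (b ∷ bs) → ≡⇒⇔ (cong (λ ρ → eval N ρ t N.≈ b) (≡.sym (values-there us))) })
          (def-reindex representation (here refl ∷ All.map there us) (def-term t))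
        Q-def : Def representation Q
        Q-def = def-all representation (domain-def s) (def-imp representation T-def D)

    def-formula : ∀ {Γ} (φ : Formula L′ Γ) → Def representation (λ as → N ⊨ φ [ as ])
    def-formula falsum = def-falsum representation
    def-formula {Γ} (equal {s} t u) = def-⇔ representation
      (λ as → mk⇔ (λ h → subst (λ ρ → eval N ρ t N.≈ eval N ρ u) (≡.sym (values-vars as)) (lower h))
                  (λ h → lift (subst (λ ρ → eval N ρ t N.≈ eval N ρ u) (values-vars as) h)))
      (def-evals (t ∷ u ∷ []) (vars Γ) (λ xs → N.equality (values xs args))
        (λ as bs e → equality-resp N _ _ (pointwise-values as bs e args))
        (def-reindex representation args (equality-def s)))
      where
      args : All (_∈ s ∷ s ∷ Γ) (s ∷ s ∷ [])
      args = here refl ∷ there (here refl) ∷ []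
    def-formula {Γ} (rel {ss} R ts) = def-⇔ representation
      (λ as → ≡⇒⇔ (cong (N.⟦ R ⟧ʳ) (≡.trans (cong (λ ρ → evals N ρ ts) (≡.sym (values-vars as)))
        (≡.sym (values-inˡ (evals N (values as (vars Γ)) ts) as)))))
      (def-evals ts (vars Γ) (λ xs → N.⟦ R ⟧ʳ (values xs (inˡ ss)))
        (λ as bs e → N.⟦⟧ʳ-resp R (pointwise-values as bs e (inˡ ss)))
        (def-reindex representation (inˡ ss) (relation-def R)))
    def-formula (imp φ ψ) = def-imp representation (def-formula φ) (def-formula ψ)
    def-formula (all s φ) = def-all representation (domain-def s) (def-formula φ)

    NIP-coding : NIP M → NIP N
    NIP-coding nip {Γ} {Δ} φ ip = nip {Γ = concatMap dim Γ} {Δ = concatMap dim Δ ++ F.Π} ψ shatter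
      where
      module F = Def (def-formula φ)
      Θ : List L.Sort
      Θ = concatMap dim Γ ++ concatMap dim Δ ++ F.Π
      gvars : ∀ {Γ : List L′.Sort} → All (_∈ Θ) (concatMap dim Γ) → Env representation Θ Γ
      gvars {Γ} = group dim {Γ = Γ}
      xvars : All (_∈ Θ) (concatMap dim Γ)
      xvars = inˡ (concatMap dim Γ)
      yvars : All (_∈ Θ) (concatMap dim Δ)
      yvars = weaken (concatMap dim Γ) (inˡ (concatMap dim Δ))
      πvars : All (_∈ Θ) F.Π
      πvars = weaken (concatMap dim Γ) (weaken (concatMap dim Δ) (vars F.Π))
      env : Env representation Θ (Γ ++ Δ)
      env = ++⁺ (gvars {Γ} xvars) (gvars {Δ} yvars)
      ψ : Formula L Θ
      ψ = F.form env πvars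
      code : ∀ {Γ} (as : N.Tuple Γ) → ∃[ xs ] Pointwise Represents {Γ} xs as
      code = pointwise-choice surjective
      shatter : HasIP M (concatMap dim Γ) (concatMap dim Δ ++ F.Π) ψ
      shatter n with ip n
      ... | a , b , h =
        (λ i → flatten dim (code (a i) .proj₁)) ,
        (λ I → ++⁺ (flatten dim (code (b I) .proj₁)) F.params) ,
        λ i I →
          let x , rx = code (a i)
              y , ry = code (b I)
              ρ = ++⁺ (flatten dim x) (++⁺ (flatten dim y) F.params)
              ex = group-values dim {Γ = Γ} ρ xvars x (values-inˡ (flatten dim x) _)
              ey = group-values dim {Γ = Δ} ρ yvars y
                     (≡.trans (values-weaken (flatten dim x) _ _) (values-inˡ (flatten dim y) _))
          in h i I ⇔-∘ ⇔-sym (F.correct env πvars ρ (++⁺ (a i) (b I))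
            (≡.trans (values-weaken (flatten dim x) _ _) (values-inʳ (flatten dim y) F.params))
            (subst (λ zs → Pointwise Represents zs (++⁺ (a i) (b I)))
              (≡.sym (≡.trans (map-++⁺ _ (gvars {Γ} xvars) (gvars {Δ} yvars)) (cong₂ ++⁺ ex ey)))
              (pointwise-++ x (a i) rx ry)))

-- Interpretations as codings

module _ {l c ℓ l′ c′ ℓ′ : Level} {L : Language l} {L′ : Language l′}
         {N : Structure L′ c′ ℓ′} {M : Structure L c ℓ} (I : Interpretation N M) where
  private
    module L = Language L
    module L′ = Language L′
    module M = Structure M
    module N = Structure N
  open Interpretation I

  private
    R : Representation {r = c ⊔ ℓ ⊔ c′ ⊔ ℓ′} N M
    R = record { dim = dim ; Represents = Represents ; surjective = surjective }

  pointwise-functional : ∀ {ss} (xs : All (λ s → M.Tuple (dim s)) ss) (as bs : N.Tuple ss) →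
                         Pointwise Represents xs as → Pointwise Represents xs bs → as N.≈* bs
  pointwise-functional []       []       []       _        _          = tt
  pointwise-functional (x ∷ xs) (a ∷ as) (b ∷ bs) (r , rs) (r′ , rs′) =
    functional r r′ , pointwise-functional xs as bs rs rs′

  -- By `functional`, two tuples with the same codes agree up to equality, so the existential in
  -- `Preimage` says the same as P for any one tuple with these codes.
  preimage-flatten : ∀ {p ss} (P : N.Tuple ss → Set p) →
    (∀ as bs → as N.≈* bs → P as → P bs) →
    ∀ (xs : All (λ s → M.Tuple (dim s)) ss) as → Pointwise Represents xs as →
    P as ⇔ Preimage P (flatten dim xs)
  preimage-flatten P P-resp xs as rs = mk⇔
    (λ p → as , subst (λ ys → Pointwise Represents ys as) (≡.sym (group-flatten dim xs)) rs , p)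
    (λ { (bs , rs′ , p) → P-resp bs as (pointwise-functional xs bs as
      (subst (λ ys → Pointwise Represents ys bs) (group-flatten dim xs) rs′) rs) p })

  definable-flatten : ∀ {p ss} {P : M.Tuple (concatMap dim ss) → Set p} (D : Definable M P) →
    let Π , b , φ , _ = D in
    ∀ {Θ} (env : Env N M R Θ ss) π (ρ : M.Tuple Θ) → values ρ π ≡ b →
    P (flatten dim (All.map (values ρ) env)) ⇔ M ⊨ rename (++⁺ (flatten dim env) π) φ [ ρ ]
  definable-flatten (Π , b , φ , h) env π ρ eq =
    ⇔-sym (sat-rename M ρ (++⁺ (flatten dim env) π) φ)
    ⇔-∘ (sat-≡ M φ (≡.sym (≡.trans (map-++⁺ _ (flatten dim env) π)
                                   (cong₂ ++⁺ (map-flatten dim _ env) eq)))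
         ⇔-∘ h (flatten dim (All.map (values ρ) env)))

  preimage-def : ∀ {p ss} (P : N.Tuple ss → Set p) →
    (∀ as bs → as N.≈* bs → P as → P bs) → Definable M (Preimage P) → Def N M R P
  preimage-def P P-resp D@(Π , b , φ , _) = record
    { Π = Π ; params = b ; form = λ env π → rename (++⁺ (flatten dim env) π) φ
    ; correct = λ env π ρ as eq rs →
        definable-flatten D env π ρ eq
        ⇔-∘ preimage-flatten P P-resp (All.map (values ρ) env) as rs }

  -- The domain is the diagonal of the equality formula: a tuple codes something iff, paired with
  -- itself, it codes two equal elements.
  interpretation-domain : ∀ s → DomainDef N M R s
  interpretation-domain s with equal-definable s
  ... | D@(Π , b , φ , _) = record
    { Π = Π ; params = b
    ; form = λ xs π → rename (++⁺ (flatten dim {Γ = s ∷ s ∷ []} (xs ∷ xs ∷ [])) π) φ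
    ; correct = λ xs π ρ eq →
        definable-flatten D (xs ∷ xs ∷ []) π ρ eq
        ⇔-∘ mk⇔
          (λ { (a , r) → to (preimage-flatten N.equality (equality-resp N)
                               (values ρ xs ∷ values ρ xs ∷ []) (a ∷ a ∷ []) (r , r , tt))
                            (Setoid.refl (N.domain s)) })
          (λ { ((a ∷ _ ∷ []) , (r , _) , _) → a ,
                subst (λ x → Represents x a) (++⁻ˡ-++⁺ (values ρ xs) _) r }) }

  interpretation-coding : Coding {r = c ⊔ ℓ ⊔ c′ ⊔ ℓ′} N M
  interpretation-coding = record
    { representation = R
    ; domain-def     = interpretation-domain
    ; equality-def   = λ s → preimage-def N.equality (equality-resp N) (equal-definable s)
    ; graph-def      = λ f → preimage-def (N.graph f) (graph-resp N f) (func-definable f)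
    ; relation-def   = λ S → preimage-def N.⟦ S ⟧ʳ (λ _ _ → N.⟦⟧ʳ-resp S) (rel-definable S) }

-- Codings by single elements

module _ {l c ℓ l′ c′ ℓ′ : Level} {L : Language l} {L′ : Language l′}
         (N : Structure L′ c′ ℓ′) (M : Structure L c ℓ)
         (sort : Language.Sort L′ → Language.Sort L)
         (code : ∀ {s} → Structure.Elem N s → Structure.Elem M (sort s)) where
  private
    module L = Language L
    module L′ = Language L′
    module M = Structure M
    module N = Structure N

    dim : L′.Sort → List L.Sort
    dim s = sort s ∷ []

    R : Representation {r = l ⊔ c} N M
    R = record
      { dim        = dim
      ; Represents = λ x a → x ≡ code a ∷ []
      ; surjective = λ a → code a ∷ [] , refl }

  codes : ∀ {Γ} → N.Tuple Γ → M.Tuple (concatMap dim Γ)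
  codes as = flatten dim (All.map (λ a → code a ∷ []) as)

  Expresses : ∀ {p Γ} → Formula L (concatMap dim Γ) → (N.Tuple Γ → Set p) → Set _
  Expresses φ P = ∀ as → P as ⇔ M ⊨ φ [ codes as ]

  expressible-def : ∀ {p Γ} {P : N.Tuple Γ → Set p} (φ : Formula L (concatMap dim Γ)) →
                    Expresses φ P → Def N M R P
  expressible-def φ h = record
    { Π = [] ; params = [] ; form = λ env _ → rename (flatten dim env) φ
    ; correct = λ env _ ρ as _ rs → ⇔-sym (sat-rename M ρ (flatten dim env) φ)
        ⇔-∘ (sat-≡ M φ (≡.sym (≡.trans (map-flatten dim _ env)
              (cong (flatten dim) (codes-unique (All.map (values ρ) env) as rs))))
        ⇔-∘ h as) }
    where
    codes-unique : ∀ {Γ} xs (as : N.Tuple Γ) → Pointwise (λ x a → x ≡ code a ∷ []) xs as →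
                   xs ≡ All.map (λ a → code a ∷ []) as
    codes-unique []       []       _        = refl
    codes-unique (x ∷ xs) (a ∷ as) (r , rs) = cong₂ _∷_ r (codes-unique xs as rs)

  -- Since `onto` makes every element of the target sort a code, truth serves as the guard, and by
  -- `code-≈` equality of codes defines equality. No parameters are involved.
  unary-coding :
    (∀ {s} (x : M.Elem (sort s)) → ∃[ a ] x ≡ code {s} a) →
    (∀ {s} (a b : N.Elem s) → a N.≈ b ⇔ code a M.≈ code b) →
    (∀ {ss s} (f : L′.Func ss s) → ∃[ φ ] Expresses φ (N.graph f)) →
    (∀ {ss} (S : L′.Rel ss) → ∃[ φ ] Expresses φ (N.⟦ S ⟧ʳ)) →
    Coding {r = l ⊔ c} N M
  unary-coding onto code-≈ func-expressible rel-expressible = record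
    { representation = R
    ; domain-def = λ s → record
        { Π = [] ; params = [] ; form = λ _ _ → imp falsum falsum
        ; correct = λ { (x ∷ []) _ ρ _ → mk⇔ (λ _ ()) (λ _ →
            let a , eq = onto (All.lookup ρ x) in a , cong (_∷ []) eq) } }
    ; equality-def = λ s → expressible-def (equal (var (here refl)) (var (there (here refl))))
        (λ { (a ∷ b ∷ []) → mk⇔ lift lower ⇔-∘ code-≈ a b })
    ; graph-def    = λ f → let φ , h = func-expressible f in expressible-def φ h
    ; relation-def = λ S → let φ , h = rel-expressible S in expressible-def φ h }

-- The field and the functions λ

module _ {c ℓ} (K : Field c ℓ) (V : LeftModule (Field.ring K) c ℓ) where

  private
    𝕂 : Structure fieldLanguage c ℓ
    𝕂 = fieldStructure K
    𝕍 : Structure vectorSpaceLanguage c ℓ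
    𝕍 = vectorSpaceStructure K V

  private
    module Args {l} {L : Language l} {s : Language.Sort L} where
      x₀ : ∀ {Γ} → Term L (s ∷ Γ) s
      x₀ = var (here refl)
      x₁ : ∀ {t Γ} → Term L (t ∷ s ∷ Γ) s
      x₁ = var (there (here refl))
      x₂ : ∀ {t u Γ} → Term L (t ∷ u ∷ s ∷ Γ) s
      x₂ = var (there (there (here refl)))
  open Args

  lift⇔ : ∀ {a b} {A : Set a} → A ⇔ Lift b A
  lift⇔ = mk⇔ lift lower

  field-coding : Coding {r = c} 𝕂 𝕍
  field-coding = unary-coding 𝕂 𝕍 (λ _ → scalar) id
    (λ x → x , refl) (λ _ _ → ⇔-id _)
    (λ { add  → equal (func add (x₁ ∷ x₂ ∷ [])) x₀ , λ { (_ ∷ _ ∷ _ ∷ []) → lift⇔ }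
       ; mul  → equal (func mul (x₁ ∷ x₂ ∷ [])) x₀ , λ { (_ ∷ _ ∷ _ ∷ []) → lift⇔ }
       ; nil  → equal (func nil []) x₀ , λ { (_ ∷ []) → lift⇔ }
       ; unit → equal (func unit []) x₀ , λ { (_ ∷ []) → lift⇔ } })
    (λ ())

  module _ (em : ∀ {a} → ExcludedMiddle a) where

    private
      𝕎 : Structure vectorSpaceLanguageWλ c ℓ
      𝕎 = vectorSpaceStructureWλ K V em

    fieldWλ-coding : Coding {r = c} 𝕂 𝕎
    fieldWλ-coding = unary-coding 𝕂 𝕎 (λ _ → scalar) id
      (λ x → x , refl) (λ _ _ → ⇔-id _)
      (λ { add  → equal (func (base add) (x₁ ∷ x₂ ∷ [])) x₀ , λ { (_ ∷ _ ∷ _ ∷ []) → lift⇔ }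
         ; mul  → equal (func (base mul) (x₁ ∷ x₂ ∷ [])) x₀ , λ { (_ ∷ _ ∷ _ ∷ []) → lift⇔ }
         ; nil  → equal (func (base nil) []) x₀ , λ { (_ ∷ []) → lift⇔ }
         ; unit → equal (func (base unit) []) x₀ , λ { (_ ∷ []) → lift⇔ } })
      (λ ())

    open Field K hiding (zero; refl; sym; trans)
    open LeftModule V
    open CommutativeMonoidSum +ᴹ-commutativeMonoid using (sum-cong-≋)

    private
      Tup : List VSort → Set c
      Tup = Structure.Tuple 𝕍
      VTerm : List VSort → VSort → Set
      VTerm = Term vectorSpaceLanguage
      VFormula : List VSort → Set
      VFormula = Formula vectorSpaceLanguage
      ⟪_⟫ : ∀ {Γ s} → VTerm Γ s → Tup Γ → Structure.Elem 𝕍 s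
      ⟪ t ⟫ ρ = eval 𝕍 ρ t

    -- Linear independence and coordinates as formulas

    ⋀ : ∀ {n Γ} → (Fin n → VFormula Γ) → VFormula Γ
    ⋀ {zero}  φ = imp falsum falsum
    ⋀ {suc n} φ = conj (φ zero) (⋀ (φ ∘ suc))

    sat-⋀ : ∀ {n Γ} (φ : Fin n → VFormula Γ) {ρ} → 𝕍 ⊨ ⋀ φ [ ρ ] ⇔ (∀ i → 𝕍 ⊨ φ i [ ρ ])
    sat-⋀ {zero}  φ = mk⇔ (λ _ ()) (λ _ → id)
    sat-⋀ {suc n} φ = mk⇔
      (λ { (p , q) zero → p ; (p , q) (suc i) → to (sat-⋀ (φ ∘ suc)) q i })
      (λ h → h zero , from (sat-⋀ (φ ∘ suc)) (h ∘ suc))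
      ⇔-∘ sat-conj 𝕍 em (φ zero) (⋀ (φ ∘ suc))

    combination : ∀ {n Γ} → (Fin n → VTerm Γ scalar) → (Fin n → VTerm Γ vector) → VTerm Γ vector
    combination {zero}  k v = func nilⱽ []
    combination {suc n} k v =
      func addⱽ (func scal (k zero ∷ v zero ∷ []) ∷ combination (k ∘ suc) (v ∘ suc) ∷ [])

    eval-combination : ∀ {n Γ} (k : Fin n → VTerm Γ scalar) (v : Fin n → VTerm Γ vector) ρ →
      ⟪ combination k v ⟫ ρ ≡ linearCombination K V (λ i → ⟪ k i ⟫ ρ) (λ i → ⟪ v i ⟫ ρ)
    eval-combination {zero}  k v ρ = refl
    eval-combination {suc n} k v ρ =
      cong (⟪ k zero ⟫ ρ *ₗ ⟪ v zero ⟫ ρ +ᴹ_) (eval-combination (k ∘ suc) (v ∘ suc) ρ)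

    scalars : ∀ n {Γ} → Fin n → VTerm (replicate n scalar ++ Γ) scalar
    scalars (suc n) zero    = x₀
    scalars (suc n) (suc i) = renameTerm (All.map there (vars _)) (scalars n i)

    lifted : ∀ n {Γ s} → VTerm Γ s → VTerm (replicate n scalar ++ Γ) s
    lifted n = renameTerm (weaken (replicate n scalar) (vars _))

    fromVector : ∀ {n} → Vector Carrier n → Tup (replicate n scalar)
    fromVector {zero}  k = []
    fromVector {suc n} k = k zero ∷ fromVector (k ∘ suc)

    eval-scalars : ∀ {n Γ} (k : Vector Carrier n) (ρ : Tup Γ) i →
                   ⟪ scalars n i ⟫ (++⁺ (fromVector k) ρ) ≡ k i
    eval-scalars {suc n} k ρ zero    = refl
    eval-scalars {suc n} k ρ (suc i) = ≡.trans
      (eval-rename 𝕍 _ (All.map there (vars _)) (scalars n i))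
      (≡.trans (cong ⟪ scalars n i ⟫ (≡.trans (values-there (vars _)) (values-vars _)))
        (eval-scalars (k ∘ suc) ρ i))

    eval-lifted : ∀ {n Γ s} (k : Tup (replicate n scalar)) (ρ : Tup Γ) (t : VTerm Γ s) →
                  ⟪ lifted n t ⟫ (++⁺ k ρ) ≡ ⟪ t ⟫ ρ
    eval-lifted k ρ t = ≡.trans (eval-rename 𝕍 _ _ t) (cong ⟪ t ⟫ (values-inʳ k ρ))

    fromVector-onto : ∀ n (ks : Tup (replicate n scalar)) → ∃[ k ] fromVector k ≡ ks
    fromVector-onto zero    []       = (λ ()) , refl
    fromVector-onto (suc n) (x ∷ ks) with fromVector-onto n ks
    ... | k , refl = (λ { zero → x ; (suc i) → k i }) , refl

    sat-alls-scalars : ∀ n {Γ} (φ : VFormula (replicate n scalar ++ Γ)) (ρ : Tup Γ) →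
      𝕍 ⊨ alls (replicate n scalar) φ [ ρ ] ⇔ (∀ k → 𝕍 ⊨ φ [ ++⁺ (fromVector k) ρ ])
    sat-alls-scalars n φ ρ = mk⇔ (λ h k → h (fromVector k))
      (λ h ks → let k , eq = fromVector-onto n ks in
        subst (λ ks → 𝕍 ⊨ φ [ ++⁺ ks ρ ]) eq (h k))
      ⇔-∘ sat-alls 𝕍 (replicate n scalar) φ ρ

    combined : ∀ {n Γ} → (Fin n → VTerm Γ vector) → VTerm (replicate n scalar ++ Γ) vector
    combined {n} v = combination (scalars n) (λ i → lifted n (v i))

    eval-combined : ∀ {n Γ} (v : Fin n → VTerm Γ vector) k (ρ : Tup Γ) →
      ⟪ combined v ⟫ (++⁺ (fromVector k) ρ) ≈ᴹ linearCombination K V k (λ i → ⟪ v i ⟫ ρ)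
    eval-combined {n} v k ρ =
      ≈ᴹ-trans (≈ᴹ-reflexive (eval-combination (scalars n) (λ i → lifted n (v i)) _))
        (sum-cong-≋ λ i → *ₗ-cong (reflexive (eval-scalars k ρ i))
          (≈ᴹ-reflexive (eval-lifted (fromVector k) ρ (v i))))

    independent : ∀ {n Γ} → (Fin n → VTerm Γ vector) → VFormula Γ
    independent {n} v = alls (replicate n scalar)
      (imp (equal (combined v) (func nilⱽ [])) (⋀ λ i → equal (scalars n i) (func nil [])))

    sat-independent : ∀ {n Γ} (v : Fin n → VTerm Γ vector) (ρ : Tup Γ) →
      𝕍 ⊨ independent v [ ρ ] ⇔ LinearlyIndependent K V (λ i → ⟪ v i ⟫ ρ)
    sat-independent {n} v ρ = ⇔-all (λ k → ⇔-imp
        (mk⇔ (≈ᴹ-trans (≈ᴹ-sym (eval-combined v k ρ)) ∘ lower)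
             (lift ∘ ≈ᴹ-trans (eval-combined v k ρ)))
        (⇔-all (λ i → mk⇔ (≈-trans (reflexive (≡.sym (eval-scalars k ρ i))) ∘ lower)
                          (lift ∘ ≈-trans (reflexive (eval-scalars k ρ i))))
          ⇔-∘ sat-⋀ (λ i → equal (scalars n i) (func nil []))))
      ⇔-∘ sat-alls-scalars n _ ρ
      where
      ≈-trans : ∀ {x y z} → x ≈ y → y ≈ z → x ≈ z
      ≈-trans = Field.trans K

    combines : ∀ {n Γ} → VTerm Γ vector → (Fin n → VTerm Γ vector) →
               VFormula (replicate n scalar ++ Γ)
    combines {n} u v = equal (lifted n u) (combined v)

    sat-combines : ∀ {n Γ} u (v : Fin n → VTerm Γ vector) k (ρ : Tup Γ) →
      𝕍 ⊨ combines u v [ ++⁺ (fromVector k) ρ ] ⇔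
      (⟪ u ⟫ ρ ≈ᴹ linearCombination K V k (λ i → ⟪ v i ⟫ ρ))
    sat-combines u v k ρ = mk⇔
      (λ { (lift e) → ≈ᴹ-trans (≈ᴹ-reflexive (≡.sym (eval-lifted (fromVector k) ρ u)))
                               (≈ᴹ-trans e (eval-combined v k ρ)) })
      (λ e → lift (≈ᴹ-trans (≈ᴹ-reflexive (eval-lifted (fromVector k) ρ u))
                            (≈ᴹ-trans e (≈ᴹ-sym (eval-combined v k ρ)))))

    spanned : ∀ {n Γ} → VTerm Γ vector → (Fin n → VTerm Γ vector) → VFormula Γ
    spanned {n} u v = neg (alls (replicate n scalar) (neg (combines u v)))

    coordinated : ∀ {n Γ} → VTerm Γ vector → (Fin n → VTerm Γ vector) → VFormula Γ
    coordinated {n} u v = conj (independent v) (spanned u v)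

    sat-coordinated : ∀ {n Γ} u (v : Fin n → VTerm Γ vector) (ρ : Tup Γ) →
      𝕍 ⊨ coordinated u v [ ρ ] ⇔ HasCoordinates K V (⟪ u ⟫ ρ) (λ i → ⟪ v i ⟫ ρ)
    sat-coordinated {n} u v ρ = mk⇔
      (λ { (ind , h) → to (sat-independent v ρ) ind , em⇒dne em λ no →
           lower (h (from (sat-alls-scalars n (neg (combines u v)) ρ) λ k e →
             lift (no (k , to (sat-combines u v k ρ) e)))) })
      (λ { (ind , k , e) → from (sat-independent v ρ) ind , λ h →
           to (sat-alls-scalars n (neg (combines u v)) ρ) h k (from (sat-combines u v k ρ) e) })
      ⇔-∘ sat-conj 𝕍 em (independent v) (spanned u v)

    uniform : ∀ {n Γ} → Fin n → VTerm Γ scalar → VTerm Γ vector → (Fin n → VTerm Γ vector) →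
              VFormula (replicate n scalar ++ Γ)
    uniform {n} i y u v = imp (combines u v) (equal (scalars n i) (lifted n y))

    -- The graph of the coordinate function with its default value 0. Requiring every coordinate
    -- tuple to have `y` in place `i` amounts to requiring it of one, since `coordinated` gives
    -- existence and independence gives uniqueness.
    coefficient : ∀ {n Γ} → Fin n → VTerm Γ scalar → VTerm Γ vector → (Fin n → VTerm Γ vector) →
                  VFormula Γ
    coefficient {n} i y u v = conj
      (imp (coordinated u v) (alls (replicate n scalar) (uniform i y u v)))
      (imp (neg (coordinated u v)) (equal (func nil []) y))

    -- Any decision `d` is allowed, since the decision made in the structure concerns vectors that
    -- are merely equal to the values of these terms. Two decisions may carry different witnesses;
    -- `coordinate-cong` compares them.
    sat-coefficient : ∀ {n Γ} i y u (v : Fin n → VTerm Γ vector) (ρ : Tup Γ) →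
      (d : Dec (HasCoordinates K V (⟪ u ⟫ ρ) (λ j → ⟪ v j ⟫ ρ))) →
      𝕍 ⊨ coefficient i y u v [ ρ ] ⇔ (coordinate K V d i ≈ ⟪ y ⟫ ρ)
    sat-coefficient {n} i y u v ρ d = by-cases d ⇔-∘ (mk⇔
        (λ { (p , q) → (λ h k → to (pointwise k) (to (sat-alls-scalars n (uniform i y u v) ρ)
                          (p (from (sat-coordinated u v ρ) h)) k)) ,
                       (λ ¬h → lower (q λ h → lift (¬h (to (sat-coordinated u v ρ) h)))) })
        (λ { (p , q) → (λ h → from (sat-alls-scalars n (uniform i y u v) ρ)
                          λ k → from (pointwise k) (p (to (sat-coordinated u v ρ) h) k)) ,
                       (λ ¬h → lift (q λ h → lower (¬h (from (sat-coordinated u v ρ) h)))) })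
      ⇔-∘ sat-conj 𝕍 em
          (imp (coordinated u v) (alls (replicate n scalar) (uniform i y u v)))
          (imp (neg (coordinated u v)) (equal (func nil []) y)))
      where
      ≈-trans : ∀ {x y z} → x ≈ y → y ≈ z → x ≈ z
      ≈-trans = Field.trans K
      HC : Set _
      HC = HasCoordinates K V (⟪ u ⟫ ρ) (λ j → ⟪ v j ⟫ ρ)
      Combines : Vector Carrier n → Set _
      Combines k = ⟪ u ⟫ ρ ≈ᴹ linearCombination K V k (λ j → ⟪ v j ⟫ ρ)
      pointwise : ∀ k → 𝕍 ⊨ uniform i y u v
                              [ ++⁺ (fromVector k) ρ ] ⇔ (Combines k → k i ≈ ⟪ y ⟫ ρ)
      pointwise k = ⇔-imp (sat-combines u v k ρ) (mk⇔
        (λ { (lift e) → ≈-trans (reflexive (≡.sym (eval-scalars k ρ i)))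
               (≈-trans e (reflexive (eval-lifted (fromVector k) ρ y))) })
        (λ e → lift (≈-trans (reflexive (eval-scalars k ρ i))
               (≈-trans e (reflexive (≡.sym (eval-lifted (fromVector k) ρ y)))))))
      by-cases : (d : Dec HC) → ((HC → ∀ k → Combines k → k i ≈ ⟪ y ⟫ ρ) ×
                                 (¬ HC → 0# ≈ ⟪ y ⟫ ρ)) ⇔ (coordinate K V d i ≈ ⟪ y ⟫ ρ)
      by-cases (yes h@(ind , k , e)) = mk⇔
        (λ { (p , _) → p h k e })
        (λ eq → (λ _ k′ e′ → ≈-trans (coefficients-unique K V ind k′ k
                   (≈ᴹ-trans (≈ᴹ-sym e′) e) i) eq) ,
                (λ ¬h → contradiction h ¬h))
      by-cases (no ¬h) = mk⇔ (λ { (_ , q) → q ¬h }) (λ eq → (λ h → contradiction h ¬h) , λ _ → eq)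

    vectors : ∀ n {Γ} → All (_∈ Γ) (concatMap (λ s → s ∷ []) (replicate n vector)) →
              Fin n → VTerm Γ vector
    vectors (suc n) (v ∷ vs) zero    = var v
    vectors (suc n) (v ∷ vs) (suc i) = vectors n vs i

    eval-vectors : ∀ n {Γ} (ρ : Tup Γ)
      (vs : All (_∈ Γ) (concatMap (λ s → s ∷ []) (replicate n vector)))
      (as : Structure.Tuple 𝕎 (replicate n vector)) →
      values ρ vs ≡ codes 𝕎 𝕍 id id as →
      ∀ i → ⟪ vectors n vs i ⟫ ρ ≡ toVector n as i
    eval-vectors (suc n) ρ (v ∷ vs) (a ∷ as) eq zero    = cong All.head eq
    eval-vectors (suc n) ρ (v ∷ vs) (a ∷ as) eq (suc i) =
      eval-vectors n ρ vs as (cong All.tail eq) i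

    Wλ-coding : Coding {r = c} 𝕎 𝕍
    Wλ-coding = unary-coding 𝕎 𝕍 id id (λ x → x , refl) (λ _ _ → ⇔-id _)
      (λ { (base addⱽ) → equal (func addⱽ (x₁ ∷ x₂ ∷ [])) x₀ , λ { (_ ∷ _ ∷ _ ∷ []) → lift⇔ }
         ; (base nilⱽ) → equal (func nilⱽ []) x₀ , λ { (_ ∷ []) → lift⇔ }
         ; (base add)  → equal (func add (x₁ ∷ x₂ ∷ [])) x₀ , λ { (_ ∷ _ ∷ _ ∷ []) → lift⇔ }
         ; (base mul)  → equal (func mul (x₁ ∷ x₂ ∷ [])) x₀ , λ { (_ ∷ _ ∷ _ ∷ []) → lift⇔ }
         ; (base nil)  → equal (func nil []) x₀ , λ { (_ ∷ []) → lift⇔ }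
         ; (base unit) → equal (func unit []) x₀ , λ { (_ ∷ []) → lift⇔ }
         ; (base scal) → equal (func scal (x₁ ∷ x₂ ∷ [])) x₀ , λ { (_ ∷ _ ∷ _ ∷ []) → lift⇔ }
         ; (coef n i)  → coefficient i x₀ x₁ (vectors n (coefVars n)) ,
             λ { (y ∷ v ∷ vs) → coef-expressed n i y v vs } })
      (λ { (W n) → independent (vectors n (vars _)) , λ vs → ⇔-sym
             (mk⇔ (LinearlyIndependent-resp K V (W-≈ n vs))
                  (LinearlyIndependent-resp K V (≈ᴹ-sym ∘ W-≈ n vs))
              ⇔-∘ sat-independent (vectors n (vars _)) (codes 𝕎 𝕍 id id vs)) })
      where
      coefVars : ∀ n → All (_∈ scalar ∷ vector ∷ concatMap (λ s → s ∷ []) (replicate n vector))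
                           (concatMap (λ s → s ∷ []) (replicate n vector))
      coefVars n = All.map there (All.map there (vars _))
      coef-≈ : ∀ n y v (vs : Tup (replicate n vector)) j →
               ⟪ vectors n (coefVars n) j ⟫ (codes 𝕎 𝕍 id id (y ∷ v ∷ vs)) ≈ᴹ toVector n vs j
      coef-≈ n y v vs j = ≈ᴹ-reflexive (eval-vectors n (codes 𝕎 𝕍 id id (y ∷ v ∷ vs)) (coefVars n) vs
        (≡.trans (values-there (All.map there (vars _)))
          (≡.trans (values-there (vars _)) (values-vars (codes 𝕎 𝕍 id id vs)))) j)
      W-≈ : ∀ n (vs : Tup (replicate n vector)) j →
            ⟪ vectors n (vars _) j ⟫ (codes 𝕎 𝕍 id id vs) ≈ᴹ toVector n vs j
      W-≈ n vs j = ≈ᴹ-reflexive (eval-vectors n (codes 𝕎 𝕍 id id vs) (vars _) vs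
        (values-vars (codes 𝕎 𝕍 id id vs)) j)
      coef-expressed : ∀ n i y v (vs : Tup (replicate n vector)) →
        Structure.graph 𝕎 (coef n i) (y ∷ v ∷ vs) ⇔
        𝕍 ⊨ coefficient i x₀ x₁ (vectors n (coefVars n)) [ codes 𝕎 𝕍 id id (y ∷ v ∷ vs) ]
      coef-expressed n i y v vs =
        ⇔-sym (sat-coefficient i x₀ x₁ us ρ em′) ⇔-∘ mk⇔
          (Field.trans K (coordinate-cong K V em′ em ≈ᴹ-refl (coef-≈ n y v vs) i))
          (Field.trans K (coordinate-cong K V em em′ ≈ᴹ-refl (≈ᴹ-sym ∘ coef-≈ n y v vs) i))
        where
        us = vectors n (coefVars n)
        ρ = codes 𝕎 𝕍 id id (y ∷ v ∷ vs)
        em′ : Dec (HasCoordinates K V v (λ j → ⟪ us j ⟫ ρ))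
        em′ = em

-- Independence

module LinearAlgebra (em : ∀ {a} → ExcludedMiddle a)
                     {c ℓ} (K : Field c ℓ) (V : LeftModule (Field.ring K) c ℓ) where
  open Field K using (Carrier; _≈_; 0#; 1#; _+_; _*_; -_)
  private module K = Field K
  open LeftModule V
  open import Relation.Binary.Reasoning.Setoid ≈ᴹ-setoid

  -- A multiple of the head plus an element of the span of the tail: in this nested form exchange
  -- and coordinates become recursions along the list.
  data Span : List Carrierᴹ → Carrierᴹ → Set (c ⊔ ℓ) where
    nil  : ∀ {v} → v ≈ᴹ 0ᴹ → Span [] v
    cons : ∀ {w ws v} k u → Span ws u → v ≈ᴹ k *ₗ w +ᴹ u → Span (w ∷ ws) v

  span-resp : ∀ {ws u v} → v ≈ᴹ u → Span ws u → Span ws v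
  span-resp e (nil e′)        = nil (≈ᴹ-trans e e′)
  span-resp e (cons k u s e′) = cons k u s (≈ᴹ-trans e e′)

  interchangeᴹ : ∀ a b c d → (a +ᴹ b) +ᴹ (c +ᴹ d) ≈ᴹ (a +ᴹ c) +ᴹ (b +ᴹ d)
  interchangeᴹ a b c d = begin
    (a +ᴹ b) +ᴹ (c +ᴹ d) ≈⟨ +ᴹ-assoc a b (c +ᴹ d) ⟩
    a +ᴹ (b +ᴹ (c +ᴹ d)) ≈⟨ +ᴹ-congˡ (+ᴹ-assoc b c d) ⟨
    a +ᴹ ((b +ᴹ c) +ᴹ d) ≈⟨ +ᴹ-congˡ (+ᴹ-congʳ (+ᴹ-comm b c)) ⟩
    a +ᴹ ((c +ᴹ b) +ᴹ d) ≈⟨ +ᴹ-congˡ (+ᴹ-assoc c b d) ⟩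
    a +ᴹ (c +ᴹ (b +ᴹ d)) ≈⟨ +ᴹ-assoc a c (b +ᴹ d) ⟨
    (a +ᴹ c) +ᴹ (b +ᴹ d) ∎

  span-there : ∀ {w ws v} → Span ws v → Span (w ∷ ws) v
  span-there {w} {ws} {v} s = cons 0# v s
    (≈ᴹ-sym (≈ᴹ-trans (+ᴹ-congʳ (*ₗ-zeroˡ w)) (+ᴹ-identityˡ v)))

  span-0 : ∀ ws → Span ws 0ᴹ
  span-0 []       = nil ≈ᴹ-refl
  span-0 (w ∷ ws) = span-there (span-0 ws)

  span-here : ∀ {w} ws → Span (w ∷ ws) w
  span-here {w} ws = cons 1# 0ᴹ (span-0 ws)
    (≈ᴹ-sym (≈ᴹ-trans (+ᴹ-identityʳ _) (*ₗ-identityˡ w)))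

  span-+ : ∀ {ws u v} → Span ws u → Span ws v → Span ws (u +ᴹ v)
  span-+ (nil e) (nil e′) = nil (≈ᴹ-trans (+ᴹ-cong e e′) (+ᴹ-identityˡ 0ᴹ))
  span-+ {w ∷ _} {u} {v} (cons k x s e) (cons k′ x′ s′ e′) = cons (k + k′) (x +ᴹ x′) (span-+ s s′)
    (begin
      u +ᴹ v                                ≈⟨ +ᴹ-cong e e′ ⟩
      (k *ₗ w +ᴹ x) +ᴹ (k′ *ₗ w +ᴹ x′)      ≈⟨ interchangeᴹ _ _ _ _ ⟩
      (k *ₗ w +ᴹ k′ *ₗ w) +ᴹ (x +ᴹ x′)      ≈⟨ +ᴹ-congʳ (*ₗ-distribʳ w k k′) ⟨
      (k + k′) *ₗ w +ᴹ (x +ᴹ x′)            ∎)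

  span-* : ∀ {ws v} k → Span ws v → Span ws (k *ₗ v)
  span-* k (nil e) = nil (≈ᴹ-trans (*ₗ-cong K.refl e) (*ₗ-zeroʳ k))
  span-* {w ∷ _} {v} k (cons k′ x s e) = cons (k * k′) (k *ₗ x) (span-* k s)
    (begin
      k *ₗ v                      ≈⟨ *ₗ-cong K.refl e ⟩
      k *ₗ (k′ *ₗ w +ᴹ x)         ≈⟨ *ₗ-distribˡ k (k′ *ₗ w) x ⟩
      k *ₗ (k′ *ₗ w) +ᴹ k *ₗ x    ≈⟨ +ᴹ-congʳ (*ₗ-assoc k k′ w) ⟨
      (k * k′) *ₗ w +ᴹ k *ₗ x     ∎)

  infix 4 _⊑_
  _⊑_ : List Carrierᴹ → List Carrierᴹ → Set (c ⊔ ℓ)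
  ws ⊑ ws′ = ∀ {v} → Span ws v → Span ws′ v

  ∷-⊑ : ∀ {w ws ws′} → Span ws′ w → ws ⊑ ws′ → w ∷ ws ⊑ ws′
  ∷-⊑ s h (cons k u s′ e) = span-resp e (span-+ (span-* k s) (h s′))

  ++-⊑ : ∀ x {ws ws′} → (∀ {u} → u ∈ x → Span ws′ u) → ws ⊑ ws′ → x ++ ws ⊑ ws′
  ++-⊑ []      h g = g
  ++-⊑ (u ∷ x) h g = ∷-⊑ (h (here refl)) (++-⊑ x (h ∘ there) g)

  span-++ʳ : ∀ x {ws} → ws ⊑ x ++ ws
  span-++ʳ []      s = s
  span-++ʳ (u ∷ x) s = span-there (span-++ʳ x s)

  span-∈ : ∀ {x ws u} → u ∈ x → Span (x ++ ws) u
  span-∈ {x = _ ∷ x} (here refl) = span-here (x ++ _)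
  span-∈ {x = _ ∷ _} (there i)   = span-there (span-∈ i)

  ++-mono : ∀ x {ws ws′} → ws ⊑ ws′ → x ++ ws ⊑ x ++ ws′
  ++-mono x h = ++-⊑ x span-∈ (span-++ʳ x ∘ h)

  ∷-++-⊑ : ∀ x {g ws} → x ++ g ∷ ws ⊑ g ∷ x ++ ws
  ∷-++-⊑ x = ++-⊑ x (span-there ∘ span-∈) (∷-⊑ (span-here _) (span-there ∘ span-++ʳ x))

  -- The triangular form of linear independence, built from the right. Thus `Ind (x ++ ws)` reads:
  -- `ws` is independent and `x` is independent over it.
  Ind : List Carrierᴹ → Set (c ⊔ ℓ)
  Ind []       = ⊤
  Ind (w ∷ ws) = ¬ Span ws w × Ind ws

  -- Shrinking the span behind `x` can only destroy dependences of `x`. A list with smaller span may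
  -- still be dependent, so independence of `ws′` is asked for separately.
  ind-mono : ∀ x {ws ws′} → ws′ ⊑ ws → Ind ws′ → Ind (x ++ ws) → Ind (x ++ ws′)
  ind-mono []      h i _       = i
  ind-mono (u ∷ x) h i (n , j) = n ∘ ++-mono x h , ind-mono x h i j

  ind-++ʳ : ∀ x {ws} → Ind (x ++ ws) → Ind ws
  ind-++ʳ []      i       = i
  ind-++ʳ (u ∷ x) (_ , i) = ind-++ʳ x i

  vanishes : ∀ u → u +ᴹ (- 1#) *ₗ u ≈ᴹ 0ᴹ
  vanishes u = begin
    u +ᴹ (- 1#) *ₗ u          ≈⟨ +ᴹ-congʳ (*ₗ-identityˡ u) ⟨
    1# *ₗ u +ᴹ (- 1#) *ₗ u    ≈⟨ *ₗ-distribʳ u 1# (- 1#) ⟨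
    (1# + - 1#) *ₗ u          ≈⟨ *ₗ-cong (K.-‿inverseʳ 1#) ≈ᴹ-refl ⟩
    0# *ₗ u                   ≈⟨ *ₗ-zeroˡ u ⟩
    0ᴹ                        ∎

  -- The coefficient of `g` cannot vanish, since `x` would then lie in the span of `ws`; so it is
  -- invertible and the equation can be solved for `g`.
  solve-head : ∀ {g x ws} → ¬ Span ws x → Span (g ∷ ws) x → Span (x ∷ ws) g
  solve-head {g} {x} {ws} n (cons k u s e) with em {P = k ≈ 0#}
  ... | yes k≈0 = contradiction (span-resp x≈u s) n
    where
    x≈u : x ≈ᴹ u
    x≈u = begin
      x               ≈⟨ e ⟩
      k *ₗ g +ᴹ u     ≈⟨ +ᴹ-congʳ (≈ᴹ-trans (*ₗ-cong k≈0 ≈ᴹ-refl) (*ₗ-zeroˡ g)) ⟩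
      0ᴹ +ᴹ u         ≈⟨ +ᴹ-identityˡ u ⟩
      u               ∎
  ... | no k≉0 = let k⁻¹ , kk⁻¹≈1 = K.inverse k k≉0 in
    cons k⁻¹ (k⁻¹ *ₗ ((- 1#) *ₗ u)) (span-* k⁻¹ (span-* (- 1#) s)) (begin
      g                                               ≈⟨ *ₗ-identityˡ g ⟨
      1# *ₗ g                                         ≈⟨ *ₗ-cong (K.trans (K.*-comm _ _) kk⁻¹≈1) ≈ᴹ-refl ⟨
      (k⁻¹ * k) *ₗ g                                  ≈⟨ *ₗ-assoc k⁻¹ k g ⟩
      k⁻¹ *ₗ (k *ₗ g)                                 ≈⟨ *ₗ-cong K.refl kg≈ ⟩
      k⁻¹ *ₗ (x +ᴹ (- 1#) *ₗ u)                       ≈⟨ *ₗ-distribˡ k⁻¹ x _ ⟩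
      k⁻¹ *ₗ x +ᴹ k⁻¹ *ₗ ((- 1#) *ₗ u)                ∎)
    where
    kg≈ : k *ₗ g ≈ᴹ x +ᴹ (- 1#) *ₗ u
    kg≈ = begin
      k *ₗ g                            ≈⟨ +ᴹ-identityʳ _ ⟨
      k *ₗ g +ᴹ 0ᴹ                      ≈⟨ +ᴹ-congˡ (vanishes u) ⟨
      k *ₗ g +ᴹ (u +ᴹ (- 1#) *ₗ u)      ≈⟨ +ᴹ-assoc _ _ _ ⟨
      (k *ₗ g +ᴹ u) +ᴹ (- 1#) *ₗ u      ≈⟨ +ᴹ-congʳ e ⟨
      x +ᴹ (- 1#) *ₗ u                  ∎

  -- If some `u` of `x` became dependent through `g`, exchange would put `g` in the span of the old
  -- vectors.
  ind-move : ∀ x {g ws} → ¬ Span (x ++ ws) g → Ind (x ++ ws) → Ind (x ++ g ∷ ws)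
  ind-move []      n i       = n , i
  ind-move (u ∷ x) n (m , i) =
    (λ s → n (solve-head m (∷-++-⊑ x s))) , ind-move x (n ∘ span-there) i

  -- The same list as `concat ps ++ ws`, but it unfolds piece by piece, each piece visibly lying
  -- over the rest.
  stack : List (List Carrierᴹ) → List Carrierᴹ → List Carrierᴹ
  stack []       ws = ws
  stack (p ∷ ps) ws = p ++ stack ps ws

  stack-concat : ∀ ps ws → stack ps ws ≡ concat ps ++ ws
  stack-concat []       ws = refl
  stack-concat (p ∷ ps) ws =
    ≡.trans (cong (p ++_) (stack-concat ps ws)) (≡.sym (++-assoc p (concat ps) ws))

  ⊑-stack : ∀ ps {ws} → ws ⊑ stack ps ws
  ⊑-stack []       s = s
  ⊑-stack (p ∷ ps) s = span-++ʳ p (⊑-stack ps s)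

  piece-⊑-stack : ∀ {p ps ws} → p ∈ ps → ∀ {u} → u ∈ p → Span (stack ps ws) u
  piece-⊑-stack {ps = p ∷ ps} (here refl) i = span-∈ i
  piece-⊑-stack {ps = p ∷ ps} (there j)   i = span-++ʳ p (piece-⊑-stack j i)

  stack-⊑ : ∀ ps {ws ws′} → (∀ {p} → p ∈ ps → ∀ {u} → u ∈ p → Span ws′ u) →
            ws ⊑ ws′ → stack ps ws ⊑ ws′
  stack-⊑ []       h g = g
  stack-⊑ (p ∷ ps) h g = ++-⊑ p (h (here refl)) (stack-⊑ ps (h ∘ there) g)

  ind-stack-move : ∀ ps {g ws} → ¬ Span (stack ps ws) g → Ind (stack ps ws) → Ind (stack ps (g ∷ ws))
  ind-stack-move ps {g} {ws} n i
    rewrite stack-concat ps ws | stack-concat ps (g ∷ ws) = ind-move (concat ps) n i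

  -- Steinitz exchange for a family of jointly independent pieces: adjoining
  -- a vector to the base costs at most one piece.
  drop-piece : ∀ p ps {g ws} → ¬ Span ws g → Ind (stack (p ∷ ps) ws) →
    ∃[ ps′ ] length ps′ ≡ length ps × (∀ {q} → q ∈ ps′ → q ∈ p ∷ ps) × Ind (stack ps′ (g ∷ ws))
  drop-piece p ps {g} {ws} n i with em {P = Span (stack ps ws) g}
  ... | no m = ps , refl , there , ind-stack-move ps m (ind-++ʳ p i)
  drop-piece p []        n i | yes s = contradiction s n
  -- Here `g` lies in the span of the pieces behind `p`, so one of those is lost instead. `p`
  -- survives because the new stack behind it stays inside the old span.
  drop-piece p (p₁ ∷ ps) n i | yes s with drop-piece p₁ ps n (ind-++ʳ p i)
  ... | ps′ , eq , sub , j =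
    p ∷ ps′ , cong suc eq , (λ { (here e) → here e ; (there k) → there (sub k) }) ,
    ind-mono p (stack-⊑ ps′ (λ k → piece-⊑-stack (sub k)) (∷-⊑ s (⊑-stack (p₁ ∷ ps)))) j i

  drop-pieces : ∀ f ps {ws} → Ind (f ++ ws) → Ind (stack ps ws) → length f ℕ.≤ length ps →
    ∃[ ps′ ] length ps′ ℕ.+ length f ≡ length ps × (∀ {q} → q ∈ ps′ → q ∈ ps) ×
             Ind (stack ps′ (f ++ ws))
  drop-pieces []      ps _       i _ = ps , ℕ.+-identityʳ _ , id , i
  drop-pieces (g ∷ f) ps (n , j) i f<ps with drop-pieces f ps j i (ℕ.<⇒≤ f<ps)
  ... | []      , eq , _ , _ = contradiction (subst (length f ℕ.<_) (≡.sym eq) f<ps) (ℕ.<-irrefl refl)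
  ... | p ∷ ps′ , eq , sub , i′ with drop-piece p ps′ n i′
  ... | ps″ , eq′ , sub′ , i″ =
    ps″ , ≡.trans (ℕ.+-suc (length ps″) (length f))
            (≡.trans (cong (λ m → suc (m ℕ.+ length f)) eq′) eq) ,
    sub ∘ sub′ , i″

  -- Pigeonhole: adjoining `f` costs `length f` pieces, so with more pieces than that one of them
  -- remains independent.
  independent-piece : ∀ f ps {ws} → Ind (f ++ ws) → Ind (stack ps ws) → length f ℕ.< length ps →
    ∃[ p ] p ∈ ps × Ind (p ++ f ++ ws)
  independent-piece f ps {ws} j i f<ps with drop-pieces f ps j i (ℕ.<⇒≤ f<ps)
  ... | []      , eq , _ , _ = contradiction (subst (length f ℕ.<_) (≡.sym eq) f<ps) (ℕ.<-irrefl refl)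
  ... | p ∷ ps′ , _ , sub , i′ =
    p , sub (here refl) , ind-mono p (⊑-stack ps′) j i′

  -- The vector removed is one in the span of those behind it. Only one is removed, even if more
  -- could be, so that pieces of a common length keep a common length.
  remove-dependent : ∀ e {ws} → Ind ws → ¬ Ind (e ++ ws) →
    ∃[ e′ ] suc (length e′) ≡ length e × e ++ ws ⊑ e′ ++ ws
  remove-dependent []      i n = contradiction i n
  remove-dependent (x ∷ e) {ws} i n with em {P = Ind (e ++ ws)}
  ... | yes j = e , refl , ∷-⊑ (em⇒dne em (λ m → n (m , j))) id
  ... | no m with remove-dependent e i m
  ... | e′ , eq , h = x ∷ e′ , cong suc eq , ∷-⊑ (span-here _) (span-there ∘ h)

  -- Greedy choice, starting at the last index. If it gets stuck, the pieces chosen so far are added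
  -- to the base, and over this base no candidate for the current index is independent.
  choose-pieces : ∀ {y} {Y : Set y} r m (e : Fin m → Y → List Carrierᴹ) →
    (∀ i y → length (e i y) ℕ.≤ r) → ∀ ws → Ind ws →
    (Σ[ h ∈ (Fin m → Y) ] Ind (stack (tabulate (λ i → e i (h i))) ws)) ⊎
    (∃[ i ] ∃[ ws′ ] Ind ws′ × ws ⊑ ws′ × length ws′ ℕ.≤ m ℕ.* r ℕ.+ length ws ×
                     (∀ y → ¬ Ind (e i y ++ ws′)))
  choose-pieces r zero e _ ws i = inj₁ ((λ ()) , i)
  choose-pieces r (suc m) e b ws i with choose-pieces r m (e ∘ suc) (b ∘ suc) ws i
  ... | inj₂ (j , ws′ , i′ , h , l , n) = inj₂ (suc j , ws′ , i′ , h ,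
          ℕ.≤-trans l (ℕ.+-monoˡ-≤ (length ws) (ℕ.m≤n+m (m ℕ.* r) r)) , n)
  ... | inj₁ (h , i′) with em {P = ∃[ y ] Ind (e zero y ++ stack (tabulate (λ j → e (suc j) (h j))) ws)}
  ... | yes (y , i″) = inj₁ ((λ { zero → y ; (suc j) → h j }) , i″)
  ... | no n = inj₂ (zero , stack ps ws , i′ , ⊑-stack ps , ℕ.≤-trans bound
                       (ℕ.+-monoˡ-≤ (length ws) (ℕ.m≤n+m (m ℕ.* r) r)) , λ y j → n (y , j))
    where
    ps : List (List Carrierᴹ)
    ps = tabulate (λ j → e (suc j) (h j))
    stack-length : ∀ {k} (p : Fin k → List Carrierᴹ) → (∀ j → length (p j) ℕ.≤ r) →
                   length (stack (tabulate p) ws) ℕ.≤ k ℕ.* r ℕ.+ length ws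
    stack-length {zero}  p q = ℕ.≤-refl
    stack-length {suc k} p q = ℕ.≤-trans (ℕ.≤-reflexive (length-++ (p zero)))
      (ℕ.≤-trans (ℕ.+-mono-≤ (q zero) (stack-length (p ∘ suc) (q ∘ suc)))
        (ℕ.≤-reflexive (≡.sym (ℕ.+-assoc r (k ℕ.* r) (length ws)))))
    bound : length (stack ps ws) ℕ.≤ m ℕ.* r ℕ.+ length ws
    bound = stack-length (λ j → e (suc j) (h j)) (λ j → b (suc j) (h j))

  ind-concat-piece : ∀ {m} (p : Fin m → List Carrierᴹ) i {ws} →
                     Ind (concat (tabulate p) ++ ws) → Ind (p i ++ ws)
  ind-concat-piece p i {ws} j = go p i (subst Ind (≡.sym (stack-concat (tabulate p) ws)) j)
    where
    go : ∀ {m} (p : Fin m → List Carrierᴹ) i → Ind (stack (tabulate p) ws) → Ind (p i ++ ws)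
    go p zero    k = ind-mono (p zero) (⊑-stack (tabulate (p ∘ suc)))
                       (ind-stack (tabulate p) k) k
      where
      ind-stack : ∀ ps → Ind (stack ps ws) → Ind ws
      ind-stack []       l = l
      ind-stack (q ∷ ps) l = ind-stack ps (ind-++ʳ q l)
    go p (suc i) k = go (p ∘ suc) i (ind-++ʳ (p zero) k)

-- Translation into the field

pointwise-map : ∀ {a p q q′ r r′ t} {A : Set a} {P : A → Set p} {Q : A → Set q} {Q′ : A → Set q′}
  {T : A → Set t} {R : ∀ {s} → Q s → T s → Set r} {R′ : ∀ {s} → Q′ s → T s → Set r′}
  (f : ∀ {s} → P s → Q s) (g : ∀ {s} → P s → Q′ s) →
  (∀ {s} (x : P s) y → R (f x) y → R′ (g x) y) →
  ∀ {Γ : List A} (xs : All P Γ) (ys : All T Γ) →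
  Pointwise R (All.map f xs) ys → Pointwise R′ (All.map g xs) ys
pointwise-map f g h []       []       _        = tt
pointwise-map f g h (x ∷ xs) (y ∷ ys) (r , rs) = h x y r , pointwise-map f g h xs ys rs

module Coordinates (em : ∀ {a} → ExcludedMiddle a)
                   {c ℓ} (K : Field c ℓ) (V : LeftModule (Field.ring K) c ℓ) where
  open LinearAlgebra em K V
  open Field K using (Carrier; _≈_; 0#; 1#; _+_; _*_; -_)
  private module K = Field K
  open LeftModule V
  open AbelianGroupProperties +ᴹ-abelianGroup using (∙-cancelˡ)
  open import Relation.Binary.Reasoning.Setoid ≈ᴹ-setoid

  private
    𝕂 : Structure fieldLanguage c ℓ
    𝕂 = fieldStructure K
    𝕍 : Structure vectorSpaceLanguage c ℓ
    𝕍 = vectorSpaceStructure K V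
    module 𝕂 = Structure 𝕂
    module 𝕍 = Structure 𝕍

  size : ℕ → List Unit.⊤
  size n = replicate n Unit.tt

  -- Missing coefficients or vectors count as zero.
  comb : ∀ n → 𝕂.Tuple (size n) → List Carrierᴹ → Carrierᴹ
  comb zero    _        _        = 0ᴹ
  comb (suc n) _        []       = 0ᴹ
  comb (suc n) (k ∷ ks) (w ∷ ws) = k *ₗ w +ᴹ comb n ks ws

  comb-cong : ∀ n (ks ks′ : 𝕂.Tuple (size n)) ws → ks 𝕂.≈* ks′ → comb n ks ws ≈ᴹ comb n ks′ ws
  comb-cong zero    _        _          _        _        = ≈ᴹ-refl
  comb-cong (suc n) (_ ∷ _)  (_ ∷ _)    []       _        = ≈ᴹ-refl
  comb-cong (suc n) (k ∷ ks) (k′ ∷ ks′) (w ∷ ws) (e , es) =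
    +ᴹ-cong (*ₗ-cong e ≈ᴹ-refl) (comb-cong n ks ks′ ws es)

  comb∈span : ∀ ws (ks : 𝕂.Tuple (size (length ws))) → Span ws (comb (length ws) ks ws)
  comb∈span []       []       = nil ≈ᴹ-refl
  comb∈span (w ∷ ws) (k ∷ ks) = cons k _ (comb∈span ws ks) ≈ᴹ-refl

  span⇒comb : ∀ {ws v} → Span ws v → ∃[ ks ] v ≈ᴹ comb (length ws) ks ws
  span⇒comb (nil e) = [] , e
  span⇒comb (cons k u s e) with span⇒comb s
  ... | ks , e′ = k ∷ ks , ≈ᴹ-trans e (+ᴹ-congˡ e′)

  -- If the head coefficients differed, dividing by their difference would put `w` in the span of
  -- `ws`.
  comb-injective : ∀ ws → Ind ws → (ks ks′ : 𝕂.Tuple (size (length ws))) →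
                   comb (length ws) ks ws ≈ᴹ comb (length ws) ks′ ws → ks 𝕂.≈* ks′
  comb-injective []       _       []       []         _ = tt
  comb-injective (w ∷ ws) (n , i) (k ∷ ks) (k′ ∷ ks′) e with em {P = k ≈ k′}
  ... | yes k≈k′ = k≈k′ , comb-injective ws i ks ks′
          (∙-cancelˡ (k *ₗ w) _ _ (≈ᴹ-trans e (+ᴹ-congʳ (*ₗ-cong (K.sym k≈k′) ≈ᴹ-refl))))
  ... | no k≉k′ = contradiction w∈ n
    where
    a a′ : Carrierᴹ
    a  = comb (length ws) ks ws
    a′ = comb (length ws) ks′ ws
    d : Carrier
    d = k + - k′
    d≉0 : ¬ d ≈ 0#
    d≉0 d≈0 = k≉k′ (K.trans (K.sym (K.+-identityʳ k)) (K.trans (K.+-congˡ (K.sym (K.-‿inverseˡ k′)))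
      (K.trans (K.sym (K.+-assoc k (- k′) k′)) (K.trans (K.+-congʳ d≈0) (K.+-identityˡ k′)))))
    d⁻¹ : Carrier
    d⁻¹ = K.inverse d d≉0 .proj₁
    dw+a≈a′ : d *ₗ w +ᴹ a ≈ᴹ a′
    dw+a≈a′ = ∙-cancelˡ (k′ *ₗ w) _ _ (begin
      k′ *ₗ w +ᴹ (d *ₗ w +ᴹ a)     ≈⟨ +ᴹ-assoc _ _ _ ⟨
      (k′ *ₗ w +ᴹ d *ₗ w) +ᴹ a     ≈⟨ +ᴹ-congʳ (*ₗ-distribʳ w k′ d) ⟨
      (k′ + d) *ₗ w +ᴹ a           ≈⟨ +ᴹ-congʳ (*ₗ-cong k′+d≈k ≈ᴹ-refl) ⟩
      k *ₗ w +ᴹ a                  ≈⟨ e ⟩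
      k′ *ₗ w +ᴹ a′                ∎)
      where
      k′+d≈k : k′ + d ≈ k
      k′+d≈k = K.trans (K.+-comm k′ d) (K.trans (K.+-assoc k (- k′) k′)
        (K.trans (K.+-congˡ (K.-‿inverseˡ k′)) (K.+-identityʳ k)))
    a∈ : Span ws a
    a∈ = comb∈span ws ks
    dw∈ : Span ws (d *ₗ w)
    dw∈ = span-resp (begin
      d *ₗ w                                   ≈⟨ +ᴹ-identityʳ _ ⟨
      d *ₗ w +ᴹ 0ᴹ                             ≈⟨ +ᴹ-congˡ (vanishes a) ⟨
      d *ₗ w +ᴹ (a +ᴹ (- 1#) *ₗ a)             ≈⟨ +ᴹ-assoc _ _ _ ⟨
      (d *ₗ w +ᴹ a) +ᴹ (- 1#) *ₗ a             ≈⟨ +ᴹ-congʳ dw+a≈a′ ⟩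
      a′ +ᴹ (- 1#) *ₗ a                        ∎)
      (span-+ (comb∈span ws ks′) (span-* (- 1#) a∈))
    w∈ : Span ws w
    w∈ = span-resp (begin
      w                   ≈⟨ *ₗ-identityˡ w ⟨
      1# *ₗ w             ≈⟨ *ₗ-cong (K.trans (K.*-comm _ _) (K.inverse d d≉0 .proj₂)) ≈ᴹ-refl ⟨
      (d⁻¹ * d) *ₗ w      ≈⟨ *ₗ-assoc d⁻¹ d w ⟩
      d⁻¹ *ₗ (d *ₗ w)     ∎) (span-* d⁻¹ dw∈)

  pad : ∀ q {d} → 𝕂.Tuple (size d) → 𝕂.Tuple (size (q ℕ.+ d))
  pad zero    ks = ks
  pad (suc q) ks = 0# ∷ pad q ks

  -- Passes from coordinates over `e ++ ws` to coordinates over `e ++ f ++ ws` by zeros in the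
  -- places of `f`. The result depends on the length of `f` alone, so it is the same for all
  -- parameters.
  insert : ∀ r q {d} → 𝕂.Tuple (size (r ℕ.+ d)) → 𝕂.Tuple (size (r ℕ.+ (q ℕ.+ d)))
  insert zero    q ks       = pad q ks
  insert (suc r) q (k ∷ ks) = k ∷ insert r q ks

  0*+ : ∀ w v → 0# *ₗ w +ᴹ v ≈ᴹ v
  0*+ w v = ≈ᴹ-trans (+ᴹ-congʳ (*ₗ-zeroˡ w)) (+ᴹ-identityˡ v)

  comb-pad : ∀ f {d} ws (ks : 𝕂.Tuple (size d)) →
             comb (length f ℕ.+ d) (pad (length f) ks) (f ++ ws) ≈ᴹ comb d ks ws
  comb-pad []      ws ks = ≈ᴹ-refl
  comb-pad (u ∷ f) ws ks = ≈ᴹ-trans (0*+ u _) (comb-pad f ws ks)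

  comb-insert : ∀ e f {d} ws (ks : 𝕂.Tuple (size (length e ℕ.+ d))) →
    comb (length e ℕ.+ (length f ℕ.+ d)) (insert (length e) (length f) ks) (e ++ f ++ ws)
      ≈ᴹ comb (length e ℕ.+ d) ks (e ++ ws)
  comb-insert []      f ws ks       = comb-pad f ws ks
  comb-insert (u ∷ e) f ws (k ∷ ks) = +ᴹ-congˡ (comb-insert e f ws ks)

  shape : ℕ → VSort → List Unit.⊤
  shape n vector = size n
  shape n scalar = size 1

  Encodes : ∀ n → List Carrierᴹ → ∀ {s} → 𝕂.Tuple (shape n s) → 𝕍.Elem s → Set ℓ
  Encodes n ws {vector} ks       v = v ≈ᴹ comb n ks ws
  Encodes n ws {scalar} (k ∷ []) x = x ≈ k

  Encodes* : ∀ n → List Carrierᴹ → ∀ {Γ} → All (λ s → 𝕂.Tuple (shape n s)) Γ → 𝕍.Tuple Γ → Set ℓ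
  Encodes* n ws = Pointwise (λ {s} → Encodes n ws {s})

  private
    KTerm : List Unit.⊤ → Set
    KTerm Θ = Term fieldLanguage Θ Unit.tt
    KTerms : List Unit.⊤ → List Unit.⊤ → Set
    KTerms Θ = All (Term fieldLanguage Θ)
    KFormula : List Unit.⊤ → Set
    KFormula = Formula fieldLanguage

  zeros : ∀ n {Θ} → KTerms Θ (size n)
  zeros zero    = []
  zeros (suc n) = func nil [] ∷ zeros n

  plus : ∀ n {Θ} → KTerms Θ (size n) → KTerms Θ (size n) → KTerms Θ (size n)
  plus zero    _        _        = []
  plus (suc n) (t ∷ ts) (u ∷ us) = func add (t ∷ u ∷ []) ∷ plus n ts us

  times : ∀ n {Θ} → KTerm Θ → KTerms Θ (size n) → KTerms Θ (size n)
  times zero    k _        = []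
  times (suc n) k (t ∷ ts) = func mul (k ∷ t ∷ []) ∷ times n k ts

  comb-zeros : ∀ n ws {Θ} (σ : 𝕂.Tuple Θ) → comb n (evals 𝕂 σ (zeros n)) ws ≈ᴹ 0ᴹ
  comb-zeros zero    ws       σ = ≈ᴹ-refl
  comb-zeros (suc n) []       σ = ≈ᴹ-refl
  comb-zeros (suc n) (w ∷ ws) σ = ≈ᴹ-trans (0*+ w _) (comb-zeros n ws σ)

  comb-plus : ∀ n ws {Θ} (σ : 𝕂.Tuple Θ) (ts us : KTerms Θ (size n)) →
    comb n (evals 𝕂 σ ts) ws +ᴹ comb n (evals 𝕂 σ us) ws ≈ᴹ comb n (evals 𝕂 σ (plus n ts us)) ws
  comb-plus zero    ws       σ []       []       = +ᴹ-identityˡ 0ᴹ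
  comb-plus (suc n) []       σ (t ∷ ts) (u ∷ us) = +ᴹ-identityˡ 0ᴹ
  comb-plus (suc n) (w ∷ ws) σ (t ∷ ts) (u ∷ us) = ≈ᴹ-trans (interchangeᴹ _ _ _ _)
    (+ᴹ-cong (≈ᴹ-sym (*ₗ-distribʳ w _ _)) (comb-plus n ws σ ts us))

  comb-times : ∀ n ws {Θ} (σ : 𝕂.Tuple Θ) k (ts : KTerms Θ (size n)) →
    eval 𝕂 σ k *ₗ comb n (evals 𝕂 σ ts) ws ≈ᴹ comb n (evals 𝕂 σ (times n k ts)) ws
  comb-times zero    ws       σ k []       = *ₗ-zeroʳ _
  comb-times (suc n) []       σ k (t ∷ ts) = *ₗ-zeroʳ _
  comb-times (suc n) (w ∷ ws) σ k (t ∷ ts) = ≈ᴹ-trans (*ₗ-distribˡ _ _ _)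
    (+ᴹ-cong (≈ᴹ-sym (*ₗ-assoc _ _ w)) (comb-times n ws σ k ts))

  TermEnv : List Unit.⊤ → ℕ → List VSort → Set
  TermEnv Θ n = All (λ s → KTerms Θ (shape n s))

  evalEnv : ∀ {Θ} n → 𝕂.Tuple Θ → ∀ {Γ} → TermEnv Θ n Γ → All (λ s → 𝕂.Tuple (shape n s)) Γ
  evalEnv n σ = All.map (λ {s} → evals 𝕂 {ss = shape n s} σ)

  translateTerm : ∀ n {Γ Θ s} → Term vectorSpaceLanguage Γ s → TermEnv Θ n Γ → KTerms Θ (shape n s)
  translateTerm n (var x)                 τ = All.lookup τ x
  translateTerm n (func addⱽ (t ∷ u ∷ [])) τ = plus n (translateTerm n t τ) (translateTerm n u τ)
  translateTerm n (func nilⱽ [])           τ = zeros n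
  translateTerm n (func add (t ∷ u ∷ []))  τ =
    func add (All.head (translateTerm n t τ) ∷ All.head (translateTerm n u τ) ∷ []) ∷ []
  translateTerm n (func mul (t ∷ u ∷ []))  τ =
    func mul (All.head (translateTerm n t τ) ∷ All.head (translateTerm n u τ) ∷ []) ∷ []
  translateTerm n (func nil [])            τ = func nil [] ∷ []
  translateTerm n (func unit [])           τ = func unit [] ∷ []
  translateTerm n (func scal (t ∷ u ∷ [])) τ =
    times n (All.head (translateTerm n t τ)) (translateTerm n u τ)

  encodes-head : ∀ n ws {Θ} (σ : 𝕂.Tuple Θ) (ts : KTerms Θ (size 1)) x →
                 Encodes n ws {scalar} (evals 𝕂 σ ts) x → x ≈ eval 𝕂 σ (All.head ts)
  encodes-head n ws σ (t ∷ []) x e = e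

  translateTerm-correct : ∀ n ws {Γ Θ s} (t : Term vectorSpaceLanguage Γ s) (τ : TermEnv Θ n Γ)
    (σ : 𝕂.Tuple Θ) ρ → Encodes* n ws (evalEnv n σ τ) ρ →
    Encodes n ws {s} (evals 𝕂 σ (translateTerm n t τ)) (eval 𝕍 ρ t)
  translateTerm-correct n ws {s = s} (var x) τ σ ρ es =
    subst (λ ks → Encodes n ws {s} ks (All.lookup ρ x)) (lookup-map τ x)
      (pointwise-lookup (evalEnv n σ τ) ρ es x)
  translateTerm-correct n ws (func addⱽ (t ∷ u ∷ [])) τ σ ρ es = ≈ᴹ-trans
    (+ᴹ-cong (translateTerm-correct n ws t τ σ ρ es) (translateTerm-correct n ws u τ σ ρ es))
    (comb-plus n ws σ (translateTerm n t τ) (translateTerm n u τ))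
  translateTerm-correct n ws (func nilⱽ [])           τ σ ρ es = ≈ᴹ-sym (comb-zeros n ws σ)
  translateTerm-correct n ws (func add (t ∷ u ∷ [])) τ σ ρ es = K.+-cong
    (encodes-head n ws σ (translateTerm n t τ) _ (translateTerm-correct n ws t τ σ ρ es))
    (encodes-head n ws σ (translateTerm n u τ) _ (translateTerm-correct n ws u τ σ ρ es))
  translateTerm-correct n ws (func mul (t ∷ u ∷ [])) τ σ ρ es = K.*-cong
    (encodes-head n ws σ (translateTerm n t τ) _ (translateTerm-correct n ws t τ σ ρ es))
    (encodes-head n ws σ (translateTerm n u τ) _ (translateTerm-correct n ws u τ σ ρ es))
  translateTerm-correct n ws (func nil [])            τ σ ρ es = K.refl
  translateTerm-correct n ws (func unit [])           τ σ ρ es = K.refl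
  translateTerm-correct n ws (func scal (t ∷ u ∷ [])) τ σ ρ es = ≈ᴹ-trans
    (*ₗ-cong (encodes-head n ws σ (translateTerm n t τ) _ (translateTerm-correct n ws t τ σ ρ es))
             (translateTerm-correct n ws u τ σ ρ es))
    (comb-times n ws σ (All.head (translateTerm n t τ)) (translateTerm n u τ))

  tupleEqual : ∀ n {Θ} → KTerms Θ (size n) → KTerms Θ (size n) → KFormula Θ
  tupleEqual zero    _        _        = imp falsum falsum
  tupleEqual (suc n) (t ∷ ts) (u ∷ us) = conj (equal t u) (tupleEqual n ts us)

  sat-tupleEqual : ∀ n {Θ} (ts us : KTerms Θ (size n)) (σ : 𝕂.Tuple Θ) →
    𝕂 ⊨ tupleEqual n ts us [ σ ] ⇔ evals 𝕂 σ ts 𝕂.≈* evals 𝕂 σ us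
  sat-tupleEqual zero    []       []       σ = mk⇔ (λ _ → tt) (λ _ → id)
  sat-tupleEqual (suc n) (t ∷ ts) (u ∷ us) σ = mk⇔
    (λ { (lift e , es) → e , to (sat-tupleEqual n ts us σ) es })
    (λ { (e , es) → lift e , from (sat-tupleEqual n ts us σ) es })
    ⇔-∘ sat-conj 𝕂 em (equal t u) (tupleEqual n ts us)

  newTerms : ∀ Δ {Θ} → KTerms (Δ ++ Θ) Δ
  newTerms Δ = All.map var (inˡ Δ)

  weakenEnv : ∀ n Δ {Θ Γ} → TermEnv Θ n Γ → TermEnv (Δ ++ Θ) n Γ
  weakenEnv n Δ = All.map (λ {s} → renameTerms {ss = shape n s} (weaken Δ (vars _)))

  padTerms : ∀ n {Θ s} → KTerms Θ (shape n s) → KTerms Θ (shape (suc n) s)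
  padTerms n {s = vector} ts = func nil [] ∷ ts
  padTerms n {s = scalar} ts = ts

  evals-var : ∀ {Θ Δ} (σ : 𝕂.Tuple Θ) (vs : All (_∈ Θ) Δ) → evals 𝕂 σ (All.map var vs) ≡ values σ vs
  evals-var σ []       = refl
  evals-var σ (v ∷ vs) = cong (_ ∷_) (evals-var σ vs)

  evals-newTerms : ∀ {Δ Θ} (xs : 𝕂.Tuple Δ) (σ : 𝕂.Tuple Θ) → evals 𝕂 (++⁺ xs σ) (newTerms Δ) ≡ xs
  evals-newTerms xs σ = ≡.trans (evals-var (++⁺ xs σ) (inˡ _)) (values-inˡ xs σ)

  evalEnv-weakenEnv : ∀ n {Δ Θ Γ} (xs : 𝕂.Tuple Δ) (σ : 𝕂.Tuple Θ) (τ : TermEnv Θ n Γ) →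
                      evalEnv n (++⁺ xs σ) (weakenEnv n Δ τ) ≡ evalEnv n σ τ
  evalEnv-weakenEnv n xs σ τ = ≡.trans (map-∘ τ) (map-cong τ λ ts →
    ≡.trans (evals-rename 𝕂 (++⁺ xs σ) _ ts) (cong (λ ρ → evals 𝕂 ρ ts) (values-inʳ xs σ)))

  -- translate b n φ describes φ relative to an independent n-tuple w, each
  -- vector variable being replaced by coordinates.  A vector quantifier ranges
  -- over the span of w and, if b holds, over one vector outside the span: all
  -- of these behave alike, so it suffices to add it to w.
  translate : ∀ (b : Bool) n {Γ Θ} → Formula vectorSpaceLanguage Γ → TermEnv Θ n Γ → KFormula Θ
  translate b n falsum               τ = falsum
  translate b n (equal {vector} t u) τ = tupleEqual n (translateTerm n t τ) (translateTerm n u τ)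
  translate b n (equal {scalar} t u) τ = tupleEqual 1 (translateTerm n t τ) (translateTerm n u τ)
  translate b n (imp φ ψ)            τ = imp (translate b n φ τ) (translate b n ψ τ)
  translate b n (all scalar φ) τ =
    alls (size 1) (translate b n φ (newTerms (size 1) ∷ weakenEnv n (size 1) τ))
  translate false n (all vector φ) τ =
    alls (size n) (translate false n φ (newTerms (size n) ∷ weakenEnv n (size n) τ))
  translate true n (all vector φ) τ = conj
    (alls (size n) (translate true n φ (newTerms (size n) ∷ weakenEnv n (size n) τ)))
    (translate true (suc n) φ ((func unit [] ∷ zeros n) ∷ All.map (λ {s} → padTerms n {s = s}) τ))

  Fresh : Set (c ⊔ ℓ)
  Fresh = ∀ ws → Ind ws → ∃[ v ] ¬ Span ws v

  -- With `false` the list is a basis; with `true` no finite independent list spans. These are the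
  -- two cases in which the vector quantifier of `translate` is exact: with `true` an instance
  -- outside the span exists at every stage, also after the frame has grown.
  Frame : Bool → List Carrierᴹ → Set (c ⊔ ℓ)
  Frame true  ws = Ind ws × Fresh
  Frame false ws = Ind ws × (∀ v → Span ws v)

  frame-ind : ∀ b {ws} → Frame b ws → Ind ws
  frame-ind true  = proj₁
  frame-ind false = proj₁

  encodes-extend : ∀ n ws {s Γ Θ} xs (σ : 𝕂.Tuple Θ) x (τ : TermEnv Θ n Γ) ρ →
    Encodes n ws {s} xs x → Encodes* n ws {Γ} (evalEnv n σ τ) ρ →
    Encodes* n ws {s ∷ Γ}
      (evalEnv n (++⁺ xs σ) (newTerms (shape n s) ∷ weakenEnv n (shape n s) τ)) (x ∷ ρ)
  encodes-extend n ws {s} xs σ x τ ρ e es =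
    subst (λ ys → Encodes n ws {s} ys x) (≡.sym (evals-newTerms xs σ)) e ,
    subst (λ ys → Encodes* n ws ys ρ) (≡.sym (evalEnv-weakenEnv n xs σ τ)) es

  encodes-new : ∀ n w ws {Γ Θ} (σ : 𝕂.Tuple Θ) (τ : TermEnv Θ n Γ) ρ →
    Encodes* n ws {Γ} (evalEnv n σ τ) ρ →
    Encodes* (suc n) (w ∷ ws) {vector ∷ Γ} (evalEnv (suc n) σ
      ((func unit [] ∷ zeros n) ∷ All.map (λ {s} → padTerms n {s = s}) τ)) (w ∷ ρ)
  encodes-new n w ws σ τ ρ es =
    ≈ᴹ-sym (≈ᴹ-trans (+ᴹ-cong (*ₗ-identityˡ w) (comb-zeros n ws σ)) (+ᴹ-identityʳ w)) ,
    subst (λ ys → Encodes* (suc n) (w ∷ ws) ys ρ) (≡.sym (map-∘ τ))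
      (pointwise-map {R = λ {s} → Encodes n ws {s}} {R′ = λ {s} → Encodes (suc n) (w ∷ ws) {s}}
        (λ {s} → evals 𝕂 {ss = shape n s} σ)
        (λ {s} ts → evals 𝕂 {ss = shape (suc n) s} σ (padTerms n {s = s} ts))
        (λ { {vector} ts v e → ≈ᴹ-trans e (≈ᴹ-sym (0*+ w _)) ; {scalar} (_ ∷ []) x e → e }) τ ρ es)

  -- The frame varies in the induction on φ, because a vector outside the span is adjoined to it.
  -- Old coordinates then receive a leading zero.
  translate-correct : ∀ b ws → Frame b ws → ∀ {Γ Θ} (φ : Formula vectorSpaceLanguage Γ)
    (τ : TermEnv Θ (length ws) Γ) (σ : 𝕂.Tuple Θ) ρ →
    Encodes* (length ws) ws (evalEnv (length ws) σ τ) ρ →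
    𝕍 ⊨ φ [ ρ ] ⇔ 𝕂 ⊨ translate b (length ws) φ τ [ σ ]
  translate-correct b ws F falsum τ σ ρ es = ⇔-id _
  translate-correct b ws F (equal {vector} t u) τ σ ρ es =
    ⇔-sym (sat-tupleEqual n (translateTerm n t τ) (translateTerm n u τ) σ) ⇔-∘ mk⇔
      (λ { (lift e) → comb-injective ws (frame-ind b F) _ _
             (≈ᴹ-trans (≈ᴹ-sym et) (≈ᴹ-trans e eu)) })
      (λ e → lift (≈ᴹ-trans et (≈ᴹ-trans (comb-cong n _ _ ws e) (≈ᴹ-sym eu))))
    where
    n = length ws
    et = translateTerm-correct n ws t τ σ ρ es
    eu = translateTerm-correct n ws u τ σ ρ es
  translate-correct b ws F (equal {scalar} t u) τ σ ρ es =
    ⇔-sym (sat-tupleEqual 1 (translateTerm n t τ) (translateTerm n u τ) σ) ⇔-∘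
      scalar-case (translateTerm n t τ) (translateTerm n u τ)
        (translateTerm-correct n ws t τ σ ρ es) (translateTerm-correct n ws u τ σ ρ es)
    where
    n = length ws
    scalar-case : ∀ ts us {x y} → Encodes n ws {scalar} (evals 𝕂 σ ts) x →
                  Encodes n ws {scalar} (evals 𝕂 σ us) y →
                  Lift c (x ≈ y) ⇔ evals 𝕂 σ ts 𝕂.≈* evals 𝕂 σ us
    scalar-case (_ ∷ []) (_ ∷ []) et eu = mk⇔
      (λ { (lift e) → K.trans (K.sym et) (K.trans e eu) , tt })
      (λ { (e , _) → lift (K.trans et (K.trans e (K.sym eu))) })
  translate-correct b ws F (imp φ ψ) τ σ ρ es =
    ⇔-imp (translate-correct b ws F φ τ σ ρ es) (translate-correct b ws F ψ τ σ ρ es)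
  translate-correct b ws F (all scalar φ) τ σ ρ es = mk⇔
    (λ h → from sat-body λ { (k ∷ []) → to (body k) (h k) })
    (λ h k → from (body k) (to sat-body h (k ∷ [])))
    where
    n = length ws
    τ′ = newTerms (size 1) ∷ weakenEnv n (size 1) τ
    sat-body = sat-alls 𝕂 (size 1) (translate b n φ τ′) σ
    body : ∀ k → 𝕍 ⊨ φ [ k ∷ ρ ] ⇔ 𝕂 ⊨ translate b n φ τ′ [ k ∷ σ ]
    body k = translate-correct b ws F φ τ′ (k ∷ σ) (k ∷ ρ)
      (encodes-extend n ws {scalar} (k ∷ []) σ k τ ρ K.refl es)
  translate-correct false ws F@(_ , spans) (all vector φ) τ σ ρ es = mk⇔
    (λ h → from sat-body λ ks → to (body ks _ ≈ᴹ-refl) (h _))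
    (λ h v → let ks , e = span⇒comb (spans v) in from (body ks v e) (to sat-body h ks))
    where
    n = length ws
    τ′ = newTerms (size n) ∷ weakenEnv n (size n) τ
    sat-body = sat-alls 𝕂 (size n) (translate false n φ τ′) σ
    -- Allowing every `v` equal to the combination avoids a separate proof that satisfaction
    -- respects equality of vectors.
    body : ∀ ks v → v ≈ᴹ comb n ks ws →
           𝕍 ⊨ φ [ v ∷ ρ ] ⇔ 𝕂 ⊨ translate false n φ τ′ [ ++⁺ ks σ ]
    body ks v e = translate-correct false ws F φ τ′ (++⁺ ks σ) (v ∷ ρ)
      (encodes-extend n ws {vector} ks σ v τ ρ e es)
  translate-correct true ws F@(ind , fresh) (all vector φ) τ σ ρ es = mk⇔
    (λ h → from sat-both
      ( from sat-body (λ ks → to (body ks _ ≈ᴹ-refl) (h _))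
      , (let v , v∉ = fresh ws ind in to (new v v∉) (h v))))
    (λ h v → by-cases (to sat-both h) v em)
    where
    n = length ws
    τ′ = newTerms (size n) ∷ weakenEnv n (size n) τ
    τ″ = (func unit [] ∷ zeros n) ∷ All.map (λ {s} → padTerms n {s = s}) τ
    inside = translate true n φ τ′
    outside = translate true (suc n) φ τ″
    sat-both = sat-conj 𝕂 em (alls (size n) inside) outside {σ}
    sat-body = sat-alls 𝕂 (size n) inside σ
    body : ∀ ks v → v ≈ᴹ comb n ks ws → 𝕍 ⊨ φ [ v ∷ ρ ] ⇔ 𝕂 ⊨ inside [ ++⁺ ks σ ]
    body ks v e = translate-correct true ws F φ τ′ (++⁺ ks σ) (v ∷ ρ)
      (encodes-extend n ws {vector} ks σ v τ ρ e es)
    -- The formula `outside` does not mention `v`, so φ has the same truth value at all vectors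
    -- outside the span. This takes the place of an automorphism argument.
    new : ∀ v → ¬ Span ws v → 𝕍 ⊨ φ [ v ∷ ρ ] ⇔ 𝕂 ⊨ outside [ σ ]
    new v v∉ = translate-correct true (v ∷ ws) ((v∉ , ind) , fresh) φ τ″ σ (v ∷ ρ)
      (encodes-new n v ws σ τ ρ es)
    by-cases : 𝕂 ⊨ alls (size n) inside [ σ ] × 𝕂 ⊨ outside [ σ ] →
               ∀ v → Dec (Span ws v) → 𝕍 ⊨ φ [ v ∷ ρ ]
    by-cases (h , _) v (yes s) = let ks , e = span⇒comb s in from (body ks v e) (to sat-body h ks)
    by-cases (_ , h) v (no v∉) = from (new v v∉) h

  module _ {Γ Δ} (φ : Formula vectorSpaceLanguage (Γ ++ Δ)) where

    fieldFormula : Bool → ∀ n → KFormula (concatMap (shape n) Γ ++ concatMap (shape n) Δ)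
    fieldFormula b n = translate b n φ (All.map (All.map var) (++⁺
      (group (shape n) {Γ = Γ} (inˡ (concatMap (shape n) Γ)))
      (group (shape n) {Γ = Δ} (weaken (concatMap (shape n) Γ) (vars _)))))

    fieldFormula-correct : ∀ b {n} ws → length ws ≡ n → Frame b ws → ∀ xs ys a b′ →
      Encodes* n ws {Γ} xs a → Encodes* n ws {Δ} ys b′ →
      𝕍 ⊨ φ [ ++⁺ a b′ ] ⇔ 𝕂 ⊨ fieldFormula b n [ ++⁺ (flatten (shape n) xs) (flatten (shape n) ys) ]
    fieldFormula-correct b {n} ws refl F xs ys a b′ ex ey =
      translate-correct b ws F φ (All.map (All.map var) env) σ (++⁺ a b′)
        (subst (λ zs → Encodes* n ws zs (++⁺ a b′)) (≡.sym evalEnv-env) (pointwise-++ xs a ex ey))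
      where
      σ = ++⁺ (flatten (shape n) xs) (flatten (shape n) ys)
      xvars = inˡ (concatMap (shape n) Γ)
      yvars = weaken (concatMap (shape n) Γ) (vars (concatMap (shape n) Δ))
      env = ++⁺ (group (shape n) {Γ = Γ} xvars) (group (shape n) {Γ = Δ} yvars)
      evalEnv-env : evalEnv n σ (All.map (All.map var) env) ≡ ++⁺ xs ys
      evalEnv-env = ≡.trans (map-∘ env) (≡.trans (map-cong env (evals-var σ))
        (≡.trans (map-++⁺ (values σ) (group (shape n) {Γ = Γ} xvars) _)
          (cong₂ ++⁺ (group-values (shape n) {Γ = Γ} σ xvars xs (values-inˡ (flatten (shape n) xs) _))
                     (group-values (shape n) {Γ = Δ} σ yvars ys (values-inʳ (flatten (shape n) xs) (flatten (shape n) ys))))))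

-- Shattered families

module _ {l c ℓ} {L : Language l} (M : Structure L c ℓ) Γ Δ (φ : Formula L (Γ ++ Δ)) where
  open Structure M using (Tuple)

  -- Arbitrary index types are allowed because the index set is later split into blocks, groups and
  -- candidates.
  Shatters : ∀ {x} {X : Set x} → (X → Tuple Γ) → Set _
  Shatters {X = X} a = (P : X → Bool) →
    Σ[ b ∈ Tuple Δ ] (∀ x → M ⊨ φ [ ++⁺ (a x) b ] ⇔ P x ≡ true)

  shatters-∘ : ∀ {x y} {X : Set x} {Y : Set y} (f : X → Y) (g : Y → X) → (∀ x → g (f x) ≡ x) →
               (a : Y → Tuple Γ) → Shatters a → Shatters (a ∘ f)
  shatters-∘ f g gf a S P = let b , h = S (P ∘ g) in b , λ x →
    subst (λ z → M ⊨ φ [ ++⁺ (a (f x)) b ] ⇔ P z ≡ true) (gf x) (h (f x))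

  shatters⇒HasIP : (∀ n → Σ[ a ∈ (Fin n → Tuple Γ) ] Shatters a) → HasIP M Γ Δ φ
  shatters⇒HasIP h n = let a , S = h n in a , (λ I → S (Vec.lookup I) .proj₁) , λ i I →
    mk⇔ (lookup⇒[]= i I) []=⇒lookup ⇔-∘ S (Vec.lookup I) .proj₂ i

  HasIP⇒shatters : HasIP M Γ Δ φ → ∀ n → Σ[ a ∈ (Fin n → Tuple Γ) ] Shatters a
  HasIP⇒shatters h n = let a , b , e = h n in a , λ P → b (Vec.tabulate P) , λ i →
    mk⇔ (λ i∈ → ≡.trans (≡.sym (lookup∘tabulate P i)) ([]=⇒lookup i∈))
        (λ eq → lookup⇒[]= i _ (≡.trans (lookup∘tabulate P i) eq))
    ⇔-∘ e i (Vec.tabulate P)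

-- Bounds on shattered families of vectors

module Shattering (em : ∀ {a} → ExcludedMiddle a)
                  {c ℓ} (K : Field c ℓ) (V : LeftModule (Field.ring K) c ℓ) where
  open LinearAlgebra em K V
  open Coordinates em K V
  open LeftModule V using (Carrierᴹ; ≈ᴹ-sym; ≈ᴹ-trans)

  private
    𝕂 : Structure fieldLanguage c ℓ
    𝕂 = fieldStructure K
    𝕍 : Structure vectorSpaceLanguage c ℓ
    𝕍 = vectorSpaceStructure K V
    module 𝕂 = Structure 𝕂
    module 𝕍 = Structure 𝕍

  ¬∀⟶∃¬ : ∀ {a p} {A : Set a} {P : A → Set p} → ¬ (∀ x → P x) → ∃[ x ] ¬ P x
  ¬∀⟶∃¬ h = em⇒dne em λ n → h λ x → em⇒dne em λ np → n (x , np)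

  Spanned : ∀ {Γ} → List Carrierᴹ → 𝕍.Tuple Γ → Set (c ⊔ ℓ)
  Spanned {Γ} ws as = (v : vector ∈ Γ) → Span ws (All.lookup as v)

  encode : ∀ {n} ws → length ws ≡ n → ∀ {Γ} (as : 𝕍.Tuple Γ) → Spanned ws as →
           ∃[ xs ] Encodes* n ws {Γ} xs as
  encode ws eq [] _ = [] , tt
  encode ws refl (_∷_ {vector} a as) s with span⇒comb (s (here refl)) | encode ws refl as (s ∘ there)
  ... | ks , e | xs , es = ks ∷ xs , e , es
  encode ws refl (_∷_ {scalar} a as) s with encode ws refl as (s ∘ there)
  ... | xs , es = (a ∷ []) ∷ xs , Field.refl K , es

  insertCode : ∀ r q {d s} → 𝕂.Tuple (shape (r ℕ.+ d) s) → 𝕂.Tuple (shape (r ℕ.+ (q ℕ.+ d)) s)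
  insertCode r q {s = vector} = insert r q
  insertCode r q {s = scalar} = id

  encodes-insert : ∀ {r q d} e f ws → length e ≡ r → length f ≡ q →
    ∀ {Γ} xs (as : 𝕍.Tuple Γ) → Encodes* (r ℕ.+ d) (e ++ ws) xs as →
    Encodes* (r ℕ.+ (q ℕ.+ d)) (e ++ f ++ ws) (All.map (λ {s} → insertCode r q {d} {s}) xs) as
  encodes-insert {r} {q} {d} e f ws refl refl xs as es =
    pointwise-map {R = λ {s} → Encodes (r ℕ.+ d) (e ++ ws) {s}}
      {R′ = λ {s} → Encodes (r ℕ.+ (q ℕ.+ d)) (e ++ f ++ ws) {s}} id (λ {s} → insertCode r q {d} {s})
      (λ { {vector} ks v eq → ≈ᴹ-trans eq (≈ᴹ-sym (comb-insert e f ws ks))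
         ; {scalar} (_ ∷ []) x eq → eq })
      xs as (subst (λ ys → Encodes* (r ℕ.+ d) (e ++ ws) ys as) (≡.sym (map-id xs)) es)

  module _ (nip : NIP 𝕂) {Γ Δ} (φ : Formula vectorSpaceLanguage (Γ ++ Δ)) where

    field-bound : ∀ b n → ∃[ N ] ¬ (∃[ a ] Shatters 𝕂 (concatMap (shape n) Γ) (concatMap (shape n) Δ)
                                             (fieldFormula {Γ} {Δ} φ b n) {X = Fin N} a)
    field-bound b n = ¬∀⟶∃¬ λ h →
      nip (fieldFormula {Γ} {Δ} φ b n) (shatters⇒HasIP 𝕂 _ _ (fieldFormula {Γ} {Δ} φ b n) h)

    finite-dimensional : ∀ ws → Frame false ws → ¬ HasIP 𝕍 Γ Δ φ
    finite-dimensional ws F ip with field-bound false (length ws)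
    ... | N , bound with HasIP⇒shatters 𝕍 Γ Δ φ ip N
    ... | a , S = bound ((λ i → flatten (shape n) (code (a i) .proj₁)) , λ P →
            let b , h = S P
                ys , ey = code b
            in flatten (shape n) ys , λ i → h i ⇔-∘ ⇔-sym (fieldFormula-correct {Γ} {Δ} φ false ws refl F
                 (code (a i) .proj₁) ys (a i) b (code (a i) .proj₂) ey))
      where
      n = length ws
      code : ∀ {Γ} (as : 𝕍.Tuple Γ) → ∃[ xs ] Encodes* n ws {Γ} xs as
      code as = encode ws refl as (λ _ → F .proj₂ _)

    module _ (fresh : Fresh) where

      -- The bounds concern bases of one exact length, so a shorter base is filled up with fresh
      -- vectors.
      extend-to : ∀ {n} ws → Ind ws → length ws ℕ.≤′ n →
                  ∃[ ws′ ] length ws′ ≡ n × Ind ws′ × ws ⊑ ws′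
      extend-to ws i (ℕ.≤′-reflexive refl) = ws , refl , i , id
      extend-to ws i (ℕ.≤′-step l) with extend-to ws i l
      ... | ws′ , eq , i′ , h with fresh ws′ i′
      ... | v , v∉ = v ∷ ws′ , cong suc eq , (v∉ , i′) , span-there ∘ h

      -- Scalars and vectors already spanned contribute a fresh dummy vector, so the number of new
      -- vectors is the same for all tuples and one field formula serves every parameter tuple.
      frame-for : ∀ ws → Ind ws → ∀ {Γ} (as : 𝕍.Tuple Γ) →
                  ∃[ f ] length f ≡ length Γ × Ind (f ++ ws) × Spanned (f ++ ws) as
      frame-for ws i [] = [] , refl , i , λ ()
      frame-for ws i (_∷_ {scalar} a as) with frame-for ws i as
      ... | f , eq , j , s with fresh (f ++ ws) j
      ... | v , v∉ = v ∷ f , cong suc eq , (v∉ , j) , λ { (there k) → span-there (s k) }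
      frame-for ws i (_∷_ {vector} a as) with frame-for ws i as
      ... | f , eq , j , s with em {P = Span (f ++ ws) a}
      ... | no a∉ = a ∷ f , cong suc eq , (a∉ , j) ,
              λ { (here refl) → span-here (f ++ ws) ; (there k) → span-there (s k) }
      ... | yes a∈ with fresh (f ++ ws) j
      ... | v , v∉ = v ∷ f , cong suc eq , (v∉ , j) ,
              λ { (here refl) → span-there a∈ ; (there k) → span-there (s k) }

      q : ℕ
      q = length Δ

      -- The pieces e i, jointly, may well be dependent over f ++ ws.
      ShattersGenerically : ∀ {v} → List Carrierᴹ → (Fin v → List Carrierᴹ) → (Fin v → 𝕍.Tuple Γ) → Set _
      ShattersGenerically {v} ws e a = (P : Fin v → Bool) →
        ∃[ b ] ∃[ f ] length f ≡ q × Spanned (f ++ ws) b × (∀ i → Ind (e i ++ f ++ ws)) ×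
                      (∀ i → 𝕍 ⊨ φ [ ++⁺ (a i) b ] ⇔ P i ≡ true)

      -- Relative to e i ++ f ++ ws the coordinates of a i do not depend on f,
      -- and those of b do not depend on i, so one field formula does it all.
      generic-bound : ∀ r d → ∃[ v ] ∀ ws → length ws ≡ d → (e : Fin v → List Carrierᴹ) →
        (∀ i → length (e i) ≡ r) → ∀ a → (∀ i → Spanned (e i ++ ws) (a i)) →
        ¬ ShattersGenerically ws e a
      generic-bound r d with field-bound true (r ℕ.+ (q ℕ.+ d))
      ... | v , bound = v , λ ws ∣ws∣ e ∣e∣ a s S →
        let code : ∀ i → ∃[ xs ] Encodes* (r ℕ.+ d) (e i ++ ws) xs (a i)
            code i = encode (e i ++ ws) (≡.trans (length-++ (e i)) (cong₂ ℕ._+_ (∣e∣ i) ∣ws∣)) (a i) (s i)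
            xs = λ i → All.map (λ {s} → insertCode r q {d} {s}) (code i .proj₁)
        in bound ((λ i → flatten (shape n) (xs i)) , λ P →
          let b , f , ∣f∣ , sb , ind , h = S P
              ys₀ , ey₀ = encode (f ++ ws) (≡.trans (length-++ f) (cong₂ ℕ._+_ ∣f∣ ∣ws∣)) b sb
              ys = All.map (λ {s} → insertCode 0 r {q ℕ.+ d} {s}) ys₀
          in flatten (shape n) ys , λ i → h i ⇔-∘ ⇔-sym
               (fieldFormula-correct {Γ} {Δ} φ true (e i ++ f ++ ws)
                 (≡.trans (length-++ (e i)) (cong₂ ℕ._+_ (∣e∣ i)
                   (≡.trans (length-++ f) (cong₂ ℕ._+_ ∣f∣ ∣ws∣))))
                 (ind i , fresh) (xs i) ys (a i) b
                 (encodes-insert (e i) f ws (∣e∣ i) ∣f∣ (code i .proj₁) (a i) (code i .proj₂))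
                 (encodes-insert [] (e i) (f ++ ws) refl (∣e∣ i) ys₀ b ey₀)))
        where
        n = r ℕ.+ (q ℕ.+ d)

      length-concat : ∀ r {v} (p : Fin v → List Carrierᴹ) → (∀ i → length (p i) ≡ r) →
                      length (concat (tabulate p)) ≡ v ℕ.* r
      length-concat r {zero}  p h = refl
      length-concat r {suc v} p h =
        ≡.trans (length-++ (p zero)) (cong₂ ℕ._+_ (h zero) (length-concat r (p ∘ suc) (h ∘ suc)))

      -- If enough pieces can be chosen independently, block by block, then
      -- every choice of parameters is generic for one of the q + 1 blocks,
      -- and a union of sets that are not cut out generically on their blocks
      -- is not cut out at all.  Otherwise some group of pieces is dependent
      -- over a larger base, and one vector of each of its pieces can be spared.
      bound : ∀ r d → ∃[ N ] ∀ ws → length ws ≡ d → Ind ws → (e : Fin N → List Carrierᴹ) →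
        (∀ i → length (e i) ≡ r) → ∀ a → (∀ i → Spanned (e i ++ ws) (a i)) → ¬ Shatters 𝕍 Γ Δ φ a
      -- When the pieces are empty, independence of `e i ++ f ++ ws` is that of `f ++ ws`, so
      -- shattering is generic.
      bound zero d with generic-bound 0 d
      ... | v , generic = v , λ ws ∣ws∣ i e ∣e∣ a s S → generic ws ∣ws∣ e ∣e∣ a s λ P →
        let b , h = S P
            f , ∣f∣ , j , sb = frame-for ws i b
        in b , f , ∣f∣ , sb , (λ k → subst (λ x → Ind (x ++ f ++ ws)) (≡.sym (empty (e k) (∣e∣ k))) j) , h
        where
        empty : ∀ (x : List Carrierᴹ) → length x ≡ 0 → x ≡ []
        empty [] _ = refl
      bound (suc r) d with generic-bound (suc r) d
      -- Two rounds of choices enlarge the base: the first by at most `suc q` blocks of `v * suc r`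
      -- vectors, the second, inside one block, by at most `v` pieces of `suc r` vectors.
      ... | v , generic with bound r (v ℕ.* suc r ℕ.+ (suc q ℕ.* (v ℕ.* suc r) ℕ.+ d))
      -- The indices form `suc q` blocks of `v` groups of `N` candidates. A choice takes one
      -- candidate from each group; `v` of them exclude generic shattering, and `N` exclude
      -- shattering with shorter pieces.
      ... | N , IH = suc q ℕ.* v ℕ.* N , λ ws ∣ws∣ ind e ∣e∣ a s S → step ws ∣ws∣ ind
              (e ∘ index) (∣e∣ ∘ index) (a ∘ index) (s ∘ index)
              (shatters-∘ 𝕍 Γ Δ φ index (regroup ∘ remQuot N) regroup-index a S)
        where
        R = v ℕ.* suc r
        D = R ℕ.+ (suc q ℕ.* R ℕ.+ d)
        X : Set
        X = Fin (suc q) × Fin v × Fin N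
        index : X → Fin (suc q ℕ.* v ℕ.* N)
        index (t , i , y) = combine (combine t i) y
        regroup : Fin (suc q ℕ.* v) × Fin N → X
        regroup (k , y) = let t , i = remQuot v k in t , i , y
        regroup-index : ∀ x → regroup (remQuot N (index x)) ≡ x
        regroup-index (t , i , y) = ≡.trans
          (cong regroup (remQuot-combine (combine t i) y))
          (cong (λ (t′ , i′) → t′ , i′ , y) (remQuot-combine t i))
        step : ∀ ws → length ws ≡ d → Ind ws → (e : X → List Carrierᴹ) →
          (∀ x → length (e x) ≡ suc r) → ∀ a → (∀ x → Spanned (e x ++ ws) (a x)) →
          ¬ Shatters 𝕍 Γ Δ φ a
        block : (X → List Carrierᴹ) → Fin (suc q) → (Fin v → Fin N) → List Carrierᴹ
        block e t y = concat (tabulate λ i → e (t , i , y i))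
        step ws ∣ws∣ ind e ∣e∣ a s S with choose-pieces R (suc q) (block e)
          (λ t y → ℕ.≤-reflexive (length-concat (suc r) _ (λ i → ∣e∣ (t , i , y i)))) ws ind
        ... | inj₁ (y , ind′) = not-generic-contradiction
          where
          -- On the chosen candidates of each block, a set that no parameters cut out generically.
          not-generic : ∀ t → ∃[ P ] ¬ _
          not-generic t = ¬∀⟶∃¬ (generic ws ∣ws∣ (λ i → e (t , i , y t i)) (λ i → ∣e∣ (t , i , y t i))
            (λ i → a (t , i , y t i)) (λ i → s (t , i , y t i)))
          not-generic-contradiction : Empty.⊥
          not-generic-contradiction =
            -- The union of these sets; the third index is ignored, as only the chosen candidates
            -- matter. A single `b` now cuts out the right set on every block.
            let b , h = S (λ (t , i , _) → not-generic t .proj₁ i)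
                f , ∣f∣ , j , sb = frame-for ws ind b
                blocks = λ t → block e t (y t)
                p , p∈ , k = independent-piece f (tabulate blocks) j ind′
                  -- There are `suc q` blocks against the `q` vectors of `f`.
                  (ℕ.≤-reflexive (≡.trans (cong suc ∣f∣) (≡.sym (length-tabulate blocks))))
                t , p≡ = ∈-tabulate⁻ {f = blocks} p∈
            in not-generic t .proj₂ (b , f , ∣f∣ , sb ,
                 (λ i → ind-concat-piece (λ i → e (t , i , y t i)) i
                          (subst (λ x → Ind (x ++ f ++ ws)) p≡ k)) ,
                 (λ i → h (t , i , y t i)))
        -- No choice of candidates makes block `t` independent over `ws₁`. Choosing group by group
        -- therefore gets stuck at some group `i`, all of whose `N` candidates are dependent over
        -- `ws₂`.
        ... | inj₂ (t , ws₁ , ind₁ , ws⊑ws₁ , ∣ws₁∣ , stuck₁)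
          with choose-pieces (suc r) v (λ i y → e (t , i , y)) (λ i y → ℕ.≤-reflexive (∣e∣ (t , i , y))) ws₁ ind₁
        ... | inj₁ (y , ind₂) =
          stuck₁ y (subst Ind (stack-concat (tabulate λ i → e (t , i , y i)) ws₁) ind₂)
        ... | inj₂ (i , ws₂ , ind₂ , ws₁⊑ws₂ , ∣ws₂∣ , stuck₂) =
          -- Dependence persists over the larger base `ws₃`, so every candidate of group `i` can
          -- spare a vector, and the hypothesis for `r` applies to this group alone.
          let ws₃ , ∣ws₃∣ , ind₃ , ws₂⊑ws₃ = extend-to ws₂ ind₂ (ℕ.≤⇒≤′ (ℕ.≤-trans ∣ws₂∣
                (ℕ.+-monoʳ-≤ R (ℕ.≤-trans ∣ws₁∣ (ℕ.≤-reflexive (cong (suc q ℕ.* R ℕ.+_) ∣ws∣))))))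
              spare = λ y → remove-dependent (e (t , i , y)) ind₃
                (λ j → stuck₂ y (ind-mono (e (t , i , y)) ws₂⊑ws₃ ind₂ j))
          in IH ws₃ ∣ws₃∣ ind₃ (λ y → spare y .proj₁)
               (λ y → ℕ.suc-injective (≡.trans (spare y .proj₂ .proj₁) (∣e∣ (t , i , y))))
               (λ y → a (t , i , y))
               (λ y k → spare y .proj₂ .proj₂
                  (++-mono (e (t , i , y)) (ws₂⊑ws₃ ∘ ws₁⊑ws₂ ∘ ws⊑ws₁) (s (t , i , y) k)))
               (λ P → let b , h = S (λ (_ , _ , y) → P y) in b , λ y → h (t , i , y))

      infinite-dimensional : ¬ HasIP 𝕍 Γ Δ φ
      -- The start of the induction: the empty base, and for each `a i` a piece of `length Γ`
      -- vectors spanning it.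
      infinite-dimensional ip with bound (length Γ) 0
      ... | N , no-shattering with HasIP⇒shatters 𝕍 Γ Δ φ ip N
      ... | a , S = no-shattering [] refl tt (λ i → f i .proj₁) (λ i → f i .proj₂ .proj₁) a
                      (λ i → f i .proj₂ .proj₂ .proj₂) S
        where
        f = λ i → frame-for [] tt (a i)

  NIP-vectorSpace : NIP 𝕂 → NIP 𝕍
  NIP-vectorSpace nip φ with em {P = ∃[ ws ] Frame false ws}
  ... | yes (ws , F) = finite-dimensional nip φ ws F
  -- Without a finite basis every finite independent list misses some vector, which is `Fresh`.
  ... | no ¬F = infinite-dimensional nip φ λ ws i → ¬∀⟶∃¬ λ spans → ¬F (ws , i , spans)

corollary1p7 : (em : ∀ {a : Level} → ExcludedMiddle a) →
    ∀ {c ℓ l c′ ℓ′ : Level} (K : Field c ℓ) (V : LeftModule (Field.ring K) c ℓ) →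
    (NIP (vectorSpaceStructure K V) ⇔ NIP (fieldStructure K))
    × (NIP (vectorSpaceStructureWλ K V em) ⇔ NIP (fieldStructure K))
    × (∀ (L′ : Language l) (N : Structure L′ c′ ℓ′) →
    Interpretation N (vectorSpaceStructure K V) →
    Interpretation (vectorSpaceStructure K V) N →
    (NIP N ⇔ NIP (fieldStructure K)))
corollary1p7 em K V =
  V⇔K ,
  -- The additional symbols are definable in V, so NIP reaches the expansion through V, without a
  -- second translation into the field.
  mk⇔ (NIP-coding _ _ (fieldWλ-coding K V em)) (NIP-coding _ _ (Wλ-coding K V em) ∘ from V⇔K) ,
  λ L′ N N-in-V V-in-N →
    mk⇔ (to V⇔K ∘ NIP-coding _ _ (interpretation-coding V-in-N))
        (NIP-coding _ _ (interpretation-coding N-in-V) ∘ from V⇔K)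
  where
  V⇔K : NIP (vectorSpaceStructure K V) ⇔ NIP (fieldStructure K)
  V⇔K = mk⇔ (NIP-coding _ _ (field-coding K V)) (Shattering.NIP-vectorSpace em K V)
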